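{- Let $k\ge1$ be a fixed integer, and for $n\ge0$ let $K_n^k$ be the categorical product of $k$ copies of the complete graph $K_n$ (its vertices are the $k$-tuples of elements of $[n]$, and two $k$-tuples are adjacent if they differ in every coordinate). Then $\{K_n^k\}_{n\ge0}$ is a two-level target sequence.
   Context: Graphs are finite and simple; $\hom(F,G)$ denotes the number of graph homomorphisms from $F$ to $G$. A sequence $\{G_q\}_{q\ge0}$ of graphs is strongly polynomial if for every fixed graph $F$ there is a polynomial $p_F$ with $\hom(F,G_q)=p_F(q)$ for all $q\ge0$. A numerical polynomial is $g\in\mathbb Q[x]$ with $g(q)\in\mathbb Z$ for all $q\in\mathbb Z$. Two-level polynomial: let $g$ be an eventually nonnegative numerical polynomial, $S=\{q\in\mathbb N: g(q)\ge0\}$, and $e:S\to\mathbb N\cup\{ -1,\infty\}$. A sequence of polynomials $\{f_q(n)\}_{q\in S}$, with $f_q$ of degree $g(q)$, is a two-level polynomial of degree function $g$ and depth function $e$ if, writing $f_q(n)=\sum_{r=0}^\infty c_r(q)n^{g(q)-r}$ with $c_r(q)=0$ for $r>g(q)$, there exist polynomials $\{\varphi_r(q)\}_{r\ge0}$ such that $c_r(q)=\varphi_r(q)$ for every $q\in S$ and every $r\le e(q)$. For $q\in\mathbb N\setminus S$ one sets $f_q=0$, $e(q)=-1$. Infinite depth means $e(q)=\infty$ for all $q\in S$. A sequence of graphs $\{H_n\}_{n\ge0}$ is a two-level target sequence if for every strongly polynomial sequence $\{G_q\}_{q\ge0}$, $\hom(G_q,H_n)$ is a two-level polynomial of infinite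 depth, i.e. there is a two-level polynomial $\{f_q(n)\}$ of infinite depth with $\hom(G_q,H_n)=f_q(n)$ for all $q,n\in\mathbb N$. -}

module Defs where

open import Data.Bool.Base using (if_then_else_)
open import Data.Fin.Base using (Fin; finToFun; fromℕ<)
import Data.Fin.Properties as Fin
open import Data.Integer.Base as ℤ using (ℤ; +_; 0ℤ)
open import Data.List.Base using (List; []; _∷_; foldr)
open import Data.Nat.Base as ℕ using (ℕ; zero; suc; NonZero; >-nonZero⁻¹)
import Data.Nat.Properties as ℕ
open import Data.Product.Base using (∃; _×_; proj₁)
open import Data.Rational.Base using (ℚ; 0ℚ; _+_; _*_; _/_)
open import Data.Vec.Base using (count; allFin)
open import Function.Base using (_∘_)
open import Level using (0ℓ)
open import Relation.Binary.Construct.Add.Extrema.NonStrict ℕ._≤_ using (_≤±_)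
open import Relation.Binary.Core using (Rel)
open import Relation.Binary.Definitions using (Decidable; Symmetric; Irreflexive)
open import Relation.Binary.PropositionalEquality.Core using (_≡_; _≢_; refl; sym)
open import Relation.Nullary.Construct.Add.Extrema using (_±; ⊥±; ⊤±; [_])
open import Relation.Nullary.Decidable using (Dec; does; ¬?; _→-dec_)
open import Relation.Nullary.Negation using (¬_)

-- Finite simple graphs (the graph with no vertices included)

record Graph : Set₁ where
  field
    size   : ℕ
    Adj    : Rel (Fin size) 0ℓ
    adj?   : Decidable Adj
    symm   : Symmetric Adj
    irrefl : Irreflexive _≡_ Adj

open Graph

IsHom : (F G : Graph) → (Fin (size F) → Fin (size G)) → Set
IsHom F G φ = ∀ u v → Adj F u v → Adj G (φ u) (φ v)

isHom? : ∀ F G φ → Dec (IsHom F G φ)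
isHom? F G φ = Fin.all? λ u → Fin.all? λ v → adj? F u v →-dec adj? G (φ u) (φ v)

-- finToFun enumerates the functions Fin (size F) → Fin (size G), each once
-- up to pointwise equality.
hom : Graph → Graph → ℕ
hom F G = count (λ c → isHom? F G (finToFun c)) (allFin (size G ℕ.^ size F))

K : ℕ → Graph
K n = record
  { size   = n
  ; Adj    = _≢_
  ; adj?   = λ u v → ¬? (u Fin.≟ v)
  ; symm   = λ u≢v → u≢v ∘ sym
  ; irrefl = λ u≡v u≢v → u≢v u≡v
  }

-- Categorical product of k copies of G.  A vertex c : Fin (size G ^ k) encodes
-- the k-tuple finToFun c.  The empty product would be a looped vertex, which is
-- not a simple graph; hence k is nonzero.
infixl 8 _^×_

_^×_ : Graph → (k : ℕ) → .{{NonZero k}} → Graph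
G ^× k = record
  { size   = size G ℕ.^ k
  ; Adj    = λ u v → ∀ (i : Fin k) → Adj G (finToFun u i) (finToFun v i)
  ; adj?   = λ u v → Fin.all? λ i → adj? G (finToFun u i) (finToFun v i)
  ; symm   = λ u~v i → symm G (u~v i)
  ; irrefl = λ { refl u~u → irrefl G refl (u~u (fromℕ< (>-nonZero⁻¹ k))) }
  }

-- Polynomials over ℚ in one variable: coefficient lists, constant term first.
-- Trailing zeros are allowed, so two lists denote the same polynomial when all
-- their coefficients agree.

Poly : Set
Poly = List ℚ

coeff : Poly → ℕ → ℚ
coeff []      _       = 0ℚ
coeff (a ∷ p) zero    = a
coeff (a ∷ p) (suc i) = coeff p i

eval : Poly → ℚ → ℚ
eval p x = foldr (λ a v → a + x * v) 0ℚ p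

IsZero : Poly → Set
IsZero p = ∀ i → coeff p i ≡ 0ℚ

HasDegree : Poly → ℕ → Set
HasDegree p d = coeff p d ≢ 0ℚ × (∀ i → d ℕ.< i → coeff p i ≡ 0ℚ)

fromℤ : ℤ → ℚ
fromℤ z = z / 1

fromℕ : ℕ → ℚ
fromℕ n = fromℤ (+ n)

record NumericalPolynomial : Set where
  field
    poly          : Poly
    integerValued : ∀ (z : ℤ) → ∃ λ (w : ℤ) → eval poly (fromℤ z) ≡ fromℤ w

  value : ℤ → ℤ
  value z = proj₁ (integerValued z)

open NumericalPolynomial

EventuallyNonnegative : NumericalPolynomial → Set
EventuallyNonnegative g = ∃ λ N → ∀ (q : ℕ) → N ℕ.≤ q → 0ℤ ℤ.≤ value g (+ q)

StronglyPolynomial : (ℕ → Graph) → Set₁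
StronglyPolynomial G =
  ∀ (F : Graph) → ∃ λ (p : Poly) → ∀ q → fromℕ (hom F (G q)) ≡ eval p (fromℕ q)

-- The set S of those q with g(q) ≥ 0
_∈S[_] : ℕ → NumericalPolynomial → Set
q ∈S[ g ] = 0ℤ ℤ.≤ value g (+ q)

-- The natural number g(q); only used for q in S
degreeAt : NumericalPolynomial → ℕ → ℕ
degreeAt g q = ℤ.∣ value g (+ q) ∣

-- The coefficient c_r in p(n) = Σ_r c_r n^(d - r), with c_r = 0 for r > d
coeffFromTop : Poly → ℕ → ℕ → ℚ
coeffFromTop p d r = if does (r ℕ.≤? d) then coeff p (d ℕ.∸ r) else 0ℚ

-- Depths lie in ℕ ∪ {-1, ∞}, with ⊥± for -1 and ⊤± for ∞.
record IsTwoLevelPolynomial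
    (g : NumericalPolynomial) (e : ℕ → ℕ ±) (f : ℕ → Poly) : Set where
  field
    eventuallyNonneg : EventuallyNonnegative g
    degree           : ∀ q → q ∈S[ g ] → HasDegree (f q) (degreeAt g q)
    φ                : ℕ → Poly
    coefficients     : ∀ q → q ∈S[ g ] → ∀ r → [ r ] ≤± e q →
                       coeffFromTop (f q) (degreeAt g q) r ≡ eval (φ r) (fromℕ q)
    f-outside        : ∀ q → ¬ (q ∈S[ g ]) → IsZero (f q)
    e-outside        : ∀ q → ¬ (q ∈S[ g ]) → e q ≡ ⊥±

InfiniteDepth : NumericalPolynomial → (ℕ → ℕ ±) → Set
InfiniteDepth g e = ∀ q → q ∈S[ g ] → e q ≡ ⊤±

TwoLevelTarget : (ℕ → Graph) → Set₁
TwoLevelTarget H =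
  ∀ (G : ℕ → Graph) → StronglyPolynomial G →
  ∃ λ (g : NumericalPolynomial) → ∃ λ (e : ℕ → ℕ ±) → ∃ λ (f : ℕ → Poly) →
    IsTwoLevelPolynomial g e f × InfiniteDepth g e ×
    (∀ q n → fromℕ (hom (G q) (H n)) ≡ eval (f q) (fromℕ n))

{-# OPTIONS --safe #-}
module Submission where

-- Write c_r(G) for the coefficient of n^(|V| - r) in the chromatic polynomial of
-- G = (V, E).  Adding a vertex v to G' multiplies the number of colourings by n
-- minus the number of colours on the neighbours of v; counting each such colour at
-- its last occurrence u gives
--     c_{r+1}(G) = c_{r+1}(G') - sum over u adjacent to v of c_r(G'_u),
-- where G'_u is G' with the later neighbours of v joined to u.  Hence the iterated
-- differences of U |-> c_r(G[U]) vanish beyond order 2r, and Moebius inversion over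
-- vertex subsets writes c_r(G) as the sum over the W with |W| <= 2r of an
-- isomorphism-invariant function of G[W].  Summing over ordered tuples of distinct
-- vertices instead, and expanding distinctness by inclusion-exclusion, turns this
-- into a fixed rational linear combination of numbers hom(F, G), so c_r(G_q) is
-- polynomial in q.  Finally hom(G, K_n^k) is the k-th power of the chromatic
-- polynomial, which has degree k |V| = k hom(K_1, G) and top coefficients that are
-- Cauchy products of the c_r.

open import Algebra.Bundles using (CommutativeMonoid)
import Algebra.Properties.CommutativeSemigroup as CommutativeSemigroupProperties
open import Data.Bool.Base using (Bool; true; false; _∧_; _∨_; not; if_then_else_; T)
open import Data.Bool.ListAction using (all)
open import Data.Bool.Properties using (∧-assoc; ∧-commutativeMonoid; ∨-zeroʳ; T-∧)
open import Data.Fin.Base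
  using (Fin; zero; suc; combine; remQuot; quotient; remainder; finToFun; lift; _↑ˡ_; _↑ʳ_)
import Data.Fin.Properties as Fin
open import Data.Integer.Base as ℤ using (-[1+_])
import Data.Integer.Properties as ℤ
open import Data.List.Base
  using (List; []; _∷_; _++_; map; concatMap; length; _ʳ++_; tabulate; allFin)
open import Data.List.Membership.Propositional using (_∈_)
import Data.List.Membership.DecPropositional as DecMembership
open import Data.List.Properties
  using (length-map; length-++; length-tabulate; map-++; map-∘; map-tabulate; ++-identityʳ)
open import Data.List.Relation.Binary.Permutation.Propositional as ↭
  using (_↭_; refl; prep; swap; ↭-sym; ↭-trans; ↭-reflexive)
open import Data.List.Relation.Binary.Permutation.Propositional.Properties
  using (shift; ++⁺ʳ; ↭-length; ↭-reverse)
open import Data.List.Relation.Unary.All as All using (All; []; _∷_)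
import Data.List.Relation.Unary.All.Properties as All
open import Data.Maybe.Base as Maybe using (Maybe; just; nothing)
open import Data.Nat.Base as ℕ using (ℕ; zero; suc; _∸_; _!; NonZero)
import Data.Nat.Properties as ℕ
open import Data.Product.Base using (_×_; _,_; ∃; proj₁; proj₂; map₁; map₂)
import Data.Product.Properties as Product
open import Data.Rational.Base as ℚ using (ℚ; 0ℚ; 1ℚ; _+_; _*_; _-_; -_; 1/_; toℚᵘ)
import Data.Rational.Properties as ℚ
open import Data.Rational.Solver using (module +-*-Solver)
import Data.Rational.Unnormalised.Base as ℚᵘ
import Data.Rational.Unnormalised.Properties as ℚᵘ
open import Data.Sum.Base as Sum using (_⊎_; inj₁)
open import Data.Unit.Base using (tt)
open import Data.Vec.Base as Vec using (Vec; []; _∷_; lookup; toList)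
import Data.Vec.Properties as Vec
open import Function.Base using (_∘_; id)
open import Function.Bundles using (mk⇔; module Equivalence)
open import Relation.Binary.PropositionalEquality
open import Relation.Nullary.Construct.Add.Extrema using (⊤±)
open import Relation.Nullary.Decidable
  using (Dec; yes; no; does; does-⇔; dec-true; dec-false; T?; ¬?; _×-dec_; _⊎-dec_)
open import Relation.Nullary.Negation using (¬_; contradiction)
open import Relation.Unary using (Decidable)
open import Defs

open +-*-Solver using (solve; con; _:=_; _:+_; _:*_; _:-_; :-_)
open CommutativeSemigroupProperties
  (CommutativeMonoid.commutativeSemigroup ∧-commutativeMonoid)
  using (interchange; x∙yz≈y∙xz; xy∙z≈xz∙y)
open Graph

-- Sums over lists

-- The bound 2r is the one Whitney's expansion suggests: up to sign c_r counts certain sets of r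
-- edges, and r edges touch at most 2r vertices. Here it comes from the recursion, where raising r
-- by one costs two differences: one to remove c_{r+1}(G'), one for the choice of u.
--
-- "Last occurrence" and "later neighbour" refer to an order, so vertices form lists. The recursion
-- then suits the degree estimate but hides that c_r does not depend on the order. That is recovered
-- by counting: for each n the number of colourings ignores the order, and a polynomial is
-- determined by its values at the naturals. This symmetry is used where subsets are traded for
-- ordered tuples, at the price of a factor m!.
--
-- G'_u has as many vertices as G', so its coefficients enter with the index shifted by exactly one.
-- Identifying vertices in the inclusion-exclusion may turn an edge into a loop; such terms are
-- zero, so only simple F occur. Coefficients past the degree vanish by the recursion itself, which
-- is why the depth is infinite.

∑ : {A : Set} → List A → (A → ℚ) → ℚ
∑ []       f = 0ℚ
∑ (x ∷ xs) f = f x + ∑ xs f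

module _ {A : Set} where

  ∑-cong-All : {f g : A → ℚ} {xs : List A} → All (λ x → f x ≡ g x) xs → ∑ xs f ≡ ∑ xs g
  ∑-cong-All []         = refl
  ∑-cong-All (eq ∷ eqs) = cong₂ _+_ eq (∑-cong-All eqs)

  ∑-cong : {f g : A → ℚ} (xs : List A) → (∀ x → f x ≡ g x) → ∑ xs f ≡ ∑ xs g
  ∑-cong xs eq = ∑-cong-All (All.universal eq xs)

  ∑-zero : {f : A → ℚ} (xs : List A) → (∀ x → f x ≡ 0ℚ) → ∑ xs f ≡ 0ℚ
  ∑-zero []       eq = refl
  ∑-zero (x ∷ xs) eq = cong₂ _+_ (eq x) (∑-zero xs eq)

  ∑-+ : (xs : List A) (f g : A → ℚ) → ∑ xs (λ x → f x + g x) ≡ ∑ xs f + ∑ xs g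
  ∑-+ []       f g = refl
  ∑-+ (x ∷ xs) f g = trans (cong (f x + g x +_) (∑-+ xs f g))
    (solve 4 (λ a b c d → (a :+ b) :+ (c :+ d) := (a :+ c) :+ (b :+ d)) refl
      (f x) (g x) (∑ xs f) (∑ xs g))

  ∑-* : (xs : List A) (c : ℚ) (f : A → ℚ) → ∑ xs (λ x → c * f x) ≡ c * ∑ xs f
  ∑-* []       c f = sym (ℚ.*-zeroʳ c)
  ∑-* (x ∷ xs) c f = trans (cong (c * f x +_) (∑-* xs c f))
    (sym (ℚ.*-distribˡ-+ c (f x) (∑ xs f)))

  ∑-- : (xs : List A) (f g : A → ℚ) → ∑ xs (λ x → f x - g x) ≡ ∑ xs f - ∑ xs g
  ∑-- []       f g = refl
  ∑-- (x ∷ xs) f g = trans (cong (f x - g x +_) (∑-- xs f g))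
    (solve 4 (λ a b c d → (a :- b) :+ (c :- d) := (a :+ c) :- (b :+ d)) refl
      (f x) (g x) (∑ xs f) (∑ xs g))

  ∑-++ : (xs ys : List A) (f : A → ℚ) → ∑ (xs ++ ys) f ≡ ∑ xs f + ∑ ys f
  ∑-++ []       ys f = sym (ℚ.+-identityˡ _)
  ∑-++ (x ∷ xs) ys f = trans (cong (f x +_) (∑-++ xs ys f)) (sym (ℚ.+-assoc (f x) _ _))

  ∑-↭ : {xs ys : List A} (f : A → ℚ) → xs ↭ ys → ∑ xs f ≡ ∑ ys f
  ∑-↭ f refl         = refl
  ∑-↭ f (prep x p)   = cong (f x +_) (∑-↭ f p)
  ∑-↭ f (swap {xs} {ys} x y p) = trans (cong (λ s → f x + (f y + s)) (∑-↭ f p))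
    (solve 3 (λ a b c → a :+ (b :+ c) := b :+ (a :+ c)) refl (f x) (f y) (∑ ys f))
  ∑-↭ f (↭.trans p q)  = trans (∑-↭ f p) (∑-↭ f q)

  ∑-map : {B : Set} (g : A → B) (xs : List A) (f : B → ℚ) → ∑ (map g xs) f ≡ ∑ xs (f ∘ g)
  ∑-map g []       f = refl
  ∑-map g (x ∷ xs) f = cong (f (g x) +_) (∑-map g xs f)

module _ {A : Set} where

  ∑-concatMap : {B : Set} (g : A → List B) (xs : List A) (f : B → ℚ) →
                ∑ (concatMap g xs) f ≡ ∑ xs (λ x → ∑ (g x) f)
  ∑-concatMap g []       f = refl
  ∑-concatMap g (x ∷ xs) f =
    trans (∑-++ (g x) _ f) (cong (∑ (g x) f +_) (∑-concatMap g xs f))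

  ∑-swap : {B : Set} (xs : List A) (ys : List B) (f : A → B → ℚ) →
           ∑ xs (λ x → ∑ ys (f x)) ≡ ∑ ys (λ y → ∑ xs (λ x → f x y))
  ∑-swap []       ys f = sym (∑-zero ys (λ _ → refl))
  ∑-swap (x ∷ xs) ys f =
    trans (cong (∑ ys (f x) +_) (∑-swap xs ys f)) (sym (∑-+ ys (f x) _))

∑< : ℕ → (ℕ → ℚ) → ℚ
∑< zero    f = 0ℚ
∑< (suc D) f = f zero + ∑< D (f ∘ suc)

∑<-cong : (D : ℕ) {f g : ℕ → ℚ} → (∀ m → f m ≡ g m) → ∑< D f ≡ ∑< D g
∑<-cong zero    eq = refl
∑<-cong (suc D) eq = cong₂ _+_ (eq zero) (∑<-cong D (eq ∘ suc))

∑<-+ : (D : ℕ) (f g : ℕ → ℚ) → ∑< D (λ m → f m + g m) ≡ ∑< D f + ∑< D g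
∑<-+ zero    f g = refl
∑<-+ (suc D) f g = trans (cong (f 0 + g 0 +_) (∑<-+ D (f ∘ suc) (g ∘ suc)))
  (solve 4 (λ a b c d → (a :+ b) :+ (c :+ d) := (a :+ c) :+ (b :+ d)) refl
    (f 0) (g 0) (∑< D (f ∘ suc)) (∑< D (g ∘ suc)))

-- Splits, sublists and arrangements of a list

splits : {A : Set} → List A → List (List A × A × List A)
splits []      = []
splits (v ∷ U) = ([] , v , U) ∷ map (λ (p , u , q) → v ∷ p , u , q) (splits U)

sublists : {A : Set} → ℕ → List A → List (List A)
sublists zero    _       = [] ∷ []
sublists (suc m) []      = []
sublists (suc m) (v ∷ V) = map (v ∷_) (sublists m V) ++ sublists (suc m) V

arrangements : {A : Set} → ℕ → List A → List (List A)
arrangements zero    _ = [] ∷ []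
arrangements (suc m) U =
  concatMap (λ (p , u , q) → map (u ∷_) (arrangements m (p ++ q))) (splits U)

module _ {A : Set} where

  splits-sound : (U : List A) → All (λ (p , u , q) → p ++ u ∷ q ≡ U) (splits U)
  splits-sound []      = []
  splits-sound (v ∷ U) = refl ∷ All.map⁺ (All.map (cong (v ∷_)) (splits-sound U))

  ∑-splits-∷ : (v : A) (U : List A) (f : List A × A × List A → ℚ) →
    ∑ (splits (v ∷ U)) f ≡ f ([] , v , U) + ∑ (splits U) (λ (p , u , q) → f (v ∷ p , u , q))
  ∑-splits-∷ v U f = cong (f ([] , v , U) +_) (∑-map _ (splits U) f)

  ∑-splits-mid : (U : List A) (f : A → ℚ) → ∑ (splits U) (λ (p , u , q) → f u) ≡ ∑ U f
  ∑-splits-mid []      f = refl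
  ∑-splits-mid (v ∷ U) f = trans (∑-splits-∷ v U (f ∘ proj₁ ∘ proj₂)) (cong (f v +_) (∑-splits-mid U f))

  ∑-arrangements-suc : (m : ℕ) (U : List A) (f : List A → ℚ) →
    ∑ (arrangements (suc m) U) f ≡
    ∑ (splits U) (λ (p , u , q) → ∑ (arrangements m (p ++ q)) (f ∘ (u ∷_)))
  ∑-arrangements-suc m U f = trans
    (∑-concatMap (λ (p , u , q) → map (u ∷_) (arrangements m (p ++ q))) (splits U) f)
    (∑-cong (splits U) (λ (p , u , q) → ∑-map (u ∷_) (arrangements m (p ++ q)) f))

-- Finite differences and Möbius inversion on vertex lists

Δ : {A : Set} → A → (List A → ℚ) → List A → ℚ
Δ v f U = f (v ∷ U) - f U

-- mobius f W = Σ_{U ⊆ W} (-1)^{|W|-|U|} f U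
mobius : {A : Set} → (List A → ℚ) → List A → ℚ
mobius f []      = f []
mobius f (v ∷ W) = mobius (Δ v f) W

-- The set-function analogue of a polynomial of degree below `D`. The lists may repeat elements, a
-- repeated element acting as a further vertex with the same adjacencies, so no freshness side
-- conditions arise.
Degree< : {A : Set} → ℕ → (List A → ℚ) → Set
Degree< zero    f = ∀ U → f U ≡ 0ℚ
Degree< (suc D) f = ∀ v → Degree< D (Δ v f)

module _ {A : Set} where

  Degree<-cong : (D : ℕ) {f g : List A → ℚ} → (∀ U → f U ≡ g U) → Degree< D f → Degree< D g
  Degree<-cong zero    eq f<0 U = trans (sym (eq U)) (f<0 U)
  Degree<-cong (suc D) eq f<D v =
    Degree<-cong D (λ U → cong₂ _-_ (eq (v ∷ U)) (eq U)) (f<D v)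

  Degree<-+ : (D : ℕ) {f g : List A → ℚ} →
              Degree< D f → Degree< D g → Degree< D (λ U → f U + g U)
  Degree<-+ zero            f<0 g<0 U = cong₂ _+_ (f<0 U) (g<0 U)
  Degree<-+ (suc D) {f} {g} f<D g<D v =
    Degree<-cong D
      (λ U → solve 4 (λ a b c d → (a :- b) :+ (c :- d) := (a :+ c) :- (b :+ d)) refl
               (f (v ∷ U)) (f U) (g (v ∷ U)) (g U))
      (Degree<-+ D (f<D v) (g<D v))

  Degree<-neg : (D : ℕ) {f : List A → ℚ} → Degree< D f → Degree< D (λ U → - f U)
  Degree<-neg zero        f<0 U = cong -_ (f<0 U)
  Degree<-neg (suc D) {f} f<D v =
    Degree<-cong D
      (λ U → solve 2 (λ a b → :- (a :- b) := :- a :- :- b) refl (f (v ∷ U)) (f U))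
      (Degree<-neg D (f<D v))

  Degree<-suc : (D : ℕ) {f : List A → ℚ} → Degree< D f → Degree< (suc D) f
  Degree<-suc zero    f<0 v U = cong₂ _-_ (f<0 (v ∷ U)) (f<0 U)
  Degree<-suc (suc D) f<D v   = Degree<-suc D (f<D v)

  Degree<-∷ : (D : ℕ) {f : List A → ℚ} (v : A) → Degree< D f → Degree< D (f ∘ (v ∷_))
  Degree<-∷ zero        v f<0 U = f<0 (v ∷ U)
  Degree<-∷ (suc D) {f} v f<D   =
    Degree<-cong (suc D)
      (λ U → solve 2 (λ a b → (a :- b) :+ b := a) refl (f (v ∷ U)) (f U))
      (Degree<-+ (suc D) {Δ v f} {f} (Degree<-suc D (f<D v)) f<D)

  Degree<-map : {B : Set} (D : ℕ) {f : List A → ℚ} (g : B → A) →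
                Degree< D f → Degree< D (f ∘ map g)
  Degree<-map zero    g f<0 U = f<0 (map g U)
  Degree<-map (suc D) g f<D v = Degree<-map D g (f<D (g v))

  -- The condition on h p q = g p u q under which summing g over the splits of
  -- a list raises the degree by at most one.
  SplitDegree< : ℕ → (List A → List A → ℚ) → Set
  SplitDegree< zero    h = ∀ p q → h p q ≡ 0ℚ
  SplitDegree< (suc D) h =
    (∀ w → SplitDegree< D (λ p q → h (w ∷ p) q - h p q)) × Degree< (suc D) (h [])

  -- A difference in `v` has two sources: the new split with middle `v` and empty prefix, and the
  -- old splits, whose prefix gains `v`. The two components of `SplitDegree<` bound exactly these.
  Degree<-splits : (D : ℕ) (g : List A → A → List A → ℚ) →
    (∀ u → SplitDegree< D (λ p q → g p u q)) →
    Degree< (suc D) (λ U → ∑ (splits U) (λ (p , u , q) → g p u q))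
  Degree<-splits zero    g g<0 v U =
    cong₂ _-_ (∑-zero (splits (v ∷ U)) (λ (p , u , q) → g<0 u p q))
              (∑-zero (splits U) (λ (p , u , q) → g<0 u p q))
  Degree<-splits (suc D) g g<D v =
    Degree<-cong (suc D) split
      (Degree<-+ (suc D) {g [] v} (proj₂ (g<D v))
        (Degree<-splits D (λ p u q → g (v ∷ p) u q - g p u q) (λ u → proj₁ (g<D u) v)))
    where
    open ≡-Reasoning
    g₀ g₁ : List A × A × List A → ℚ
    g₀ (p , u , q) = g p u q
    g₁ (p , u , q) = g (v ∷ p) u q
    split : ∀ U → g [] v U + ∑ (splits U) (λ (p , u , q) → g (v ∷ p) u q - g p u q) ≡
                  ∑ (splits (v ∷ U)) g₀ - ∑ (splits U) g₀
    split U = begin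
      g [] v U + ∑ (splits U) (λ x → g₁ x - g₀ x)
        ≡⟨ cong (g [] v U +_) (∑-- (splits U) g₁ g₀) ⟩
      g [] v U + (∑ (splits U) g₁ - ∑ (splits U) g₀)
        ≡⟨ ℚ.+-assoc (g [] v U) _ _ ⟨
      g [] v U + ∑ (splits U) g₁ - ∑ (splits U) g₀
        ≡⟨ cong (_- ∑ (splits U) g₀) (∑-splits-∷ v U g₀) ⟨
      ∑ (splits (v ∷ U)) g₀ - ∑ (splits U) g₀ ∎

  SplitDegree<-* : (D : ℕ) (c : ℚ) {h : List A → List A → ℚ} →
                   SplitDegree< D h → SplitDegree< D (λ p q → c * h p q)
  SplitDegree<-* zero    c h<0 p q = trans (cong (c *_) (h<0 p q)) (ℚ.*-zeroʳ c)
  SplitDegree<-* (suc D) c {h} (Δh<D , h[]<D) =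
    (λ w → SplitDegree<-cong D
             (λ p q → solve 3 (λ k a b → k :* (a :- b) := k :* a :- k :* b) refl
                        c (h (w ∷ p) q) (h p q))
             (SplitDegree<-* D c (Δh<D w))) ,
    Degree<-* (suc D) h[]<D
    where
    Degree<-* : (D : ℕ) {f : List A → ℚ} → Degree< D f → Degree< D (λ U → c * f U)
    Degree<-* zero        f<0 U = trans (cong (c *_) (f<0 U)) (ℚ.*-zeroʳ c)
    Degree<-* (suc D) {f} f<D v =
      Degree<-cong D
        (λ U → solve 3 (λ k a b → k :* (a :- b) := k :* a :- k :* b) refl c (f (v ∷ U)) (f U))
        (Degree<-* D (f<D v))
    SplitDegree<-cong : (D : ℕ) {h k : List A → List A → ℚ} → (∀ p q → h p q ≡ k p q) →
                        SplitDegree< D h → SplitDegree< D k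
    SplitDegree<-cong zero    eq h<0 p q = trans (sym (eq p q)) (h<0 p q)
    SplitDegree<-cong (suc D) eq (Δh<D , h[]<D) =
      (λ w → SplitDegree<-cong D (λ p q → cong₂ _-_ (eq (w ∷ p) q) (eq p q)) (Δh<D w)) ,
      Degree<-cong (suc D) (eq []) h[]<D

module _ {A : Set} where

  -- Lengthening the prefix by `w` is a difference in `just w` at the front of the list, so it
  -- lowers the degree as usual; with empty prefix, `nothing` is merely a fixed first element.
  SplitDegree<-insert : (D : ℕ) {f : List (Maybe A) → ℚ} → Degree< D f →
    SplitDegree< D (λ p q → f (map just p ++ nothing ∷ map just q))
  SplitDegree<-insert zero    f<0 p q = f<0 _
  SplitDegree<-insert (suc D) {f} f<D =
    (λ w → SplitDegree<-insert D (f<D (just w))) ,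
    Degree<-map (suc D) {f ∘ (nothing ∷_)} just (Degree<-∷ (suc D) {f} nothing f<D)

  mobius-cong : {f g : List A → ℚ} (W : List A) → (∀ U → f U ≡ g U) → mobius f W ≡ mobius g W
  mobius-cong []      eq = eq []
  mobius-cong (v ∷ W) eq = mobius-cong W (λ U → cong₂ _-_ (eq (v ∷ U)) (eq U))

  mobius-map : {B : Set} (f : List A → ℚ) (g : B → A) (W : List B) →
               mobius f (map g W) ≡ mobius (f ∘ map g) W
  mobius-map f g []      = refl
  mobius-map f g (v ∷ W) = mobius-map (Δ (g v) f) g W

  -- Pascal's recursion: the sublists of `v ∷ V` that contain `v` give the inversion of `Δ v f`, of
  -- degree one less, and the others give that of `f`; together they make `Δ v f V + f V`.
  mobius-inversion : (D : ℕ) {f : List A → ℚ} → Degree< D f → (V : List A) →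
                     ∑< D (λ m → ∑ (sublists m V) (mobius f)) ≡ f V
  mobius-inversion zero        f<0 V  = sym (f<0 V)
  mobius-inversion (suc D) {f} f<D [] =
    trans (cong (∑ (sublists {A} 0 []) (mobius f) +_) (zeros D))
      (solve 1 (λ a → (a :+ con 0ℚ) :+ con 0ℚ := a) refl (f []))
    where
    zeros : ∀ D → ∑< D (λ _ → 0ℚ) ≡ 0ℚ
    zeros zero    = refl
    zeros (suc D) = trans (ℚ.+-identityˡ _) (zeros D)
  mobius-inversion (suc D) {f} f<D (v ∷ V) = begin
    s₀ + ∑< D (λ m → ∑ (sublists (suc m) (v ∷ V)) (mobius f))
      ≡⟨ cong (s₀ +_) (∑<-cong D (λ m →
           trans (∑-++ (map (v ∷_) (sublists m V)) _ _)
                 (cong (_+ s (suc m)) (∑-map (v ∷_) (sublists m V) (mobius f))))) ⟩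
    s₀ + ∑< D (λ m → t m + s (suc m))
      ≡⟨ cong (s₀ +_) (∑<-+ D t (s ∘ suc)) ⟩
    s₀ + (∑< D t + ∑< D (s ∘ suc))
      ≡⟨ solve 3 (λ a b c → a :+ (b :+ c) := b :+ (a :+ c)) refl s₀ (∑< D t) (∑< D (s ∘ suc)) ⟩
    ∑< D t + (s₀ + ∑< D (s ∘ suc))
      ≡⟨ cong₂ _+_ (mobius-inversion D (f<D v) V) (mobius-inversion (suc D) {f} f<D V) ⟩
    Δ v f V + f V
      ≡⟨ solve 2 (λ a b → (a :- b) :+ b := a) refl (f (v ∷ V)) (f V) ⟩
    f (v ∷ V) ∎
    where
    open ≡-Reasoning
    s₀ = ∑ (sublists 0 V) (mobius f)
    s t : ℕ → ℚ
    s m = ∑ (sublists m V) (mobius f)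
    t m = ∑ (sublists m V) (mobius (Δ v f))

Symmetric : {A : Set} → (List A → ℚ) → Set
Symmetric f = ∀ {U W} → U ↭ W → f U ≡ f W

module _ {A : Set} where

  mobius-symmetric : {f : List A → ℚ} → Symmetric f → Symmetric (mobius f)
  mobius-symmetric         f-sym refl        = refl
  mobius-symmetric {f}     f-sym (prep v p)  =
    mobius-symmetric (λ q → cong₂ _-_ (f-sym (prep v q)) (f-sym q)) p
  mobius-symmetric {f} f-sym (swap {xs} {ys} u v p) = trans
    (mobius-cong xs (λ U → trans
      (cong (λ x → x - f (v ∷ U) - (f (u ∷ U) - f U)) (f-sym (swap u v refl)))
      (solve 4 (λ a b c d → (a :- b) :- (c :- d) := (a :- c) :- (b :- d)) refl
        (f (v ∷ u ∷ U)) (f (v ∷ U)) (f (u ∷ U)) (f U))))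
    (mobius-symmetric {Δ u (Δ v f)}
      (λ q → cong₂ _-_ (cong₂ _-_ (f-sym (prep v (prep u q))) (f-sym (prep u q)))
                       (cong₂ _-_ (f-sym (prep v q)) (f-sym q))) p)
  mobius-symmetric         f-sym (↭.trans p q) =
    trans (mobius-symmetric f-sym p) (mobius-symmetric f-sym q)

-- Integers as rationals

fromℤ-mkℚᵘ : ∀ z → toℚᵘ (fromℤ z) ℚᵘ.≃ ℚᵘ.mkℚᵘ z 0
fromℤ-mkℚᵘ z = ℚ.toℚᵘ-fromℚᵘ (ℚᵘ.mkℚᵘ z 0)

fromℤ-injective : ∀ {y z} → fromℤ y ≡ fromℤ z → y ≡ z
fromℤ-injective {y} {z} eq
  with ℚᵘ.*≡* y*1≡z*1 ← ℚ./-injective-≃ (ℚᵘ.mkℚᵘ y 0) (ℚᵘ.mkℚᵘ z 0) eq =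
  trans (sym (ℤ.*-identityʳ y)) (trans y*1≡z*1 (ℤ.*-identityʳ z))

fromℤ-+ : ∀ y z → fromℤ (y ℤ.+ z) ≡ fromℤ y + fromℤ z
fromℤ-+ y z = ℚ.toℚᵘ-injective (begin
  toℚᵘ (fromℤ (y ℤ.+ z))                ≈⟨ fromℤ-mkℚᵘ (y ℤ.+ z) ⟩
  ℚᵘ.mkℚᵘ (y ℤ.+ z) 0                   ≈⟨ ℚᵘ.*≡* (cong (ℤ._* ℤ.+ 1)
    (cong₂ ℤ._+_ (sym (ℤ.*-identityʳ y)) (sym (ℤ.*-identityʳ z)))) ⟩
  ℚᵘ.mkℚᵘ y 0 ℚᵘ.+ ℚᵘ.mkℚᵘ z 0          ≈⟨ ℚᵘ.+-cong (fromℤ-mkℚᵘ y) (fromℤ-mkℚᵘ z) ⟨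
  toℚᵘ (fromℤ y) ℚᵘ.+ toℚᵘ (fromℤ z)    ≈⟨ ℚ.toℚᵘ-homo-+ (fromℤ y) (fromℤ z) ⟨
  toℚᵘ (fromℤ y + fromℤ z)              ∎)
  where open ℚᵘ.≃-Reasoning

fromℤ-* : ∀ y z → fromℤ (y ℤ.* z) ≡ fromℤ y * fromℤ z
fromℤ-* y z = ℚ.toℚᵘ-injective (begin
  toℚᵘ (fromℤ (y ℤ.* z))                ≈⟨ fromℤ-mkℚᵘ (y ℤ.* z) ⟩
  ℚᵘ.mkℚᵘ y 0 ℚᵘ.* ℚᵘ.mkℚᵘ z 0          ≈⟨ ℚᵘ.*-cong (fromℤ-mkℚᵘ y) (fromℤ-mkℚᵘ z) ⟨
  toℚᵘ (fromℤ y) ℚᵘ.* toℚᵘ (fromℤ z)    ≈⟨ ℚ.toℚᵘ-homo-* (fromℤ y) (fromℤ z) ⟨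
  toℚᵘ (fromℤ y * fromℤ z)              ∎)
  where open ℚᵘ.≃-Reasoning

fromℤ-neg : ∀ z → fromℤ (ℤ.- z) ≡ - fromℤ z
fromℤ-neg z = begin
  fromℤ (ℤ.- z)
    ≡⟨ solve 2 (λ a b → a := (a :+ b) :- b) refl (fromℤ (ℤ.- z)) (fromℤ z) ⟩
  fromℤ (ℤ.- z) + fromℤ z - fromℤ z   ≡⟨ cong (_- fromℤ z) (fromℤ-+ (ℤ.- z) z) ⟨
  fromℤ (ℤ.- z ℤ.+ z) - fromℤ z       ≡⟨ cong (λ x → fromℤ x - fromℤ z) (ℤ.+-inverseˡ z) ⟩
  0ℚ - fromℤ z                        ≡⟨ ℚ.+-identityˡ _ ⟩
  - fromℤ z                           ∎
  where open ≡-Reasoning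

fromℕ-+ : ∀ m n → fromℕ (m ℕ.+ n) ≡ fromℕ m + fromℕ n
fromℕ-+ m n = trans (cong fromℤ (ℤ.pos-+ m n)) (fromℤ-+ (ℤ.+ m) (ℤ.+ n))

fromℕ-suc : ∀ n → fromℕ (suc n) ≡ 1ℚ + fromℕ n
fromℕ-suc = fromℕ-+ 1

fromℕ-* : ∀ m n → fromℕ (m ℕ.* n) ≡ fromℕ m * fromℕ n
fromℕ-* m n = trans (cong fromℤ (ℤ.pos-* m n)) (fromℤ-* (ℤ.+ m) (ℤ.+ n))

fromℕ-injective : ∀ {m n} → fromℕ m ≡ fromℕ n → m ≡ n
fromℕ-injective = ℤ.+-injective ∘ fromℤ-injective

-- Sums over ordered tuples of distinct elements

module _ {A : Set} where

  -- Either v is not used, or moving it to the front is possible by symmetry;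
  -- it has suc m positions to come from.
  ∑-arrangements-∷ : (m : ℕ) {f : List A → ℚ} → Symmetric f → (v : A) (U : List A) →
    ∑ (arrangements (suc m) (v ∷ U)) f ≡
    fromℕ (suc m) * ∑ (arrangements m U) (f ∘ (v ∷_)) + ∑ (arrangements (suc m) U) f
  ∑-arrangements-∷ m {f} f-sym v U = begin
    ∑ (arrangements (suc m) (v ∷ U)) f
      ≡⟨ ∑-arrangements-suc m (v ∷ U) f ⟩
    ∑ (splits (v ∷ U)) (λ (p , u , q) → ∑ (arrangements m (p ++ q)) (f ∘ (u ∷_)))
      ≡⟨ ∑-splits-∷ v U (λ (p , u , q) → ∑ (arrangements m (p ++ q)) (f ∘ (u ∷_))) ⟩
    a + ∑ (splits U) (λ (p , u , q) → ∑ (arrangements m (v ∷ p ++ q)) (f ∘ (u ∷_)))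
      ≡⟨ cong (a +_) (later m f-sym) ⟩
    a + (fromℕ m * a + ∑ (arrangements (suc m) U) f)
      ≡⟨ solve 3 (λ a n b → a :+ (n :* a :+ b) := (con 1ℚ :+ n) :* a :+ b) refl
           a (fromℕ m) (∑ (arrangements (suc m) U) f) ⟩
    (1ℚ + fromℕ m) * a + ∑ (arrangements (suc m) U) f
      ≡⟨ cong (λ n → n * a + ∑ (arrangements (suc m) U) f) (fromℕ-suc m) ⟨
    fromℕ (suc m) * a + ∑ (arrangements (suc m) U) f ∎
    where
    open ≡-Reasoning
    a = ∑ (arrangements m U) (f ∘ (v ∷_))
    later : ∀ m {f} → Symmetric f →
      ∑ (splits U) (λ (p , u , q) → ∑ (arrangements m (v ∷ p ++ q)) (f ∘ (u ∷_))) ≡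
      fromℕ m * ∑ (arrangements m U) (f ∘ (v ∷_)) + ∑ (arrangements (suc m) U) f
    later zero    {f} f-sym = trans (sym (∑-arrangements-suc 0 U f))
      (solve 2 (λ a b → b := con 0ℚ :* a :+ b) refl
        (∑ (arrangements 0 U) (f ∘ (v ∷_))) (∑ (arrangements 1 U) f))
    later (suc m) {f} f-sym = begin
      ∑ (splits U) (λ (p , u , q) → ∑ (arrangements (suc m) (v ∷ p ++ q)) (f ∘ (u ∷_)))
        ≡⟨ ∑-cong (splits U) (λ (p , u , q) →
             trans (∑-arrangements-∷ m (λ r → f-sym (prep u r)) v (p ++ q))
               (cong (λ x → fromℕ (suc m) * x + ∑ (arrangements (suc m) (p ++ q)) (f ∘ (u ∷_)))
                 (∑-cong (arrangements m (p ++ q)) (λ W → f-sym (swap u v refl))))) ⟩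
      ∑ (splits U) (λ (p , u , q) →
        fromℕ (suc m) * ∑ (arrangements m (p ++ q)) (λ W → f (v ∷ u ∷ W)) +
        ∑ (arrangements (suc m) (p ++ q)) (f ∘ (u ∷_)))
        ≡⟨ ∑-+ (splits U) _ _ ⟩
      ∑ (splits U) (λ (p , u , q) →
        fromℕ (suc m) * ∑ (arrangements m (p ++ q)) (λ W → f (v ∷ u ∷ W))) +
      ∑ (splits U) (λ (p , u , q) → ∑ (arrangements (suc m) (p ++ q)) (f ∘ (u ∷_)))
        ≡⟨ cong₂ _+_
             (trans (∑-* (splits U) (fromℕ (suc m)) _)
                    (cong (fromℕ (suc m) *_) (sym (∑-arrangements-suc m U (f ∘ (v ∷_))))))
             (sym (∑-arrangements-suc (suc m) U f)) ⟩
      fromℕ (suc m) * ∑ (arrangements (suc m) U) (f ∘ (v ∷_)) +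
      ∑ (arrangements (suc (suc m)) U) f ∎

  -- Each sublist of length `m` is arranged in `m !` orders, which `f` does not distinguish; the
  -- factors `suc m` of `∑-arrangements-∷` accumulate to the factorial.
  ∑-arrangements-sublists : (m : ℕ) {f : List A → ℚ} → Symmetric f → (U : List A) →
    ∑ (arrangements m U) f ≡ fromℕ (m !) * ∑ (sublists m U) f
  ∑-arrangements-sublists zero    {f} f-sym U       = sym (ℚ.*-identityˡ _)
  ∑-arrangements-sublists (suc m) {f} f-sym []      = sym (ℚ.*-zeroʳ (fromℕ (suc m !)))
  ∑-arrangements-sublists (suc m) {f} f-sym (v ∷ U) = begin
    ∑ (arrangements (suc m) (v ∷ U)) f
      ≡⟨ ∑-arrangements-∷ m f-sym v U ⟩
    fromℕ (suc m) * ∑ (arrangements m U) (f ∘ (v ∷_)) + ∑ (arrangements (suc m) U) f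
      ≡⟨ cong₂ (λ x y → fromℕ (suc m) * x + y)
           (∑-arrangements-sublists m (λ r → f-sym (prep v r)) U)
           (∑-arrangements-sublists (suc m) f-sym U) ⟩
    fromℕ (suc m) * (fromℕ (m !) * s₁) + fromℕ (suc m !) * s₂
      ≡⟨ cong (_+ fromℕ (suc m !) * s₂) (ℚ.*-assoc (fromℕ (suc m)) _ _) ⟨
    fromℕ (suc m) * fromℕ (m !) * s₁ + fromℕ (suc m !) * s₂
      ≡⟨ cong (λ x → x * s₁ + fromℕ (suc m !) * s₂) (fromℕ-* (suc m) (m !)) ⟨
    fromℕ (suc m !) * s₁ + fromℕ (suc m !) * s₂
      ≡⟨ ℚ.*-distribˡ-+ (fromℕ (suc m !)) s₁ s₂ ⟨
    fromℕ (suc m !) * (s₁ + s₂)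
      ≡⟨ cong (fromℕ (suc m !) *_) (trans (∑-++ (map (v ∷_) (sublists m U)) _ f)
           (cong (_+ s₂) (∑-map (v ∷_) (sublists m U) f))) ⟨
    fromℕ (suc m !) * ∑ (sublists (suc m) (v ∷ U)) f ∎
    where
    open ≡-Reasoning
    s₁ = ∑ (sublists m U) (f ∘ (v ∷_))
    s₂ = ∑ (sublists (suc m) U) f

  -- Each new element is to differ from those already chosen: its choice is a sum
  -- over V minus a sum over us, so that no equality test on A is involved.
  ∑-fresh : List A → ℕ → (List A → ℚ) → List A → ℚ
  ∑-fresh V zero    f us = f us
  ∑-fresh V (suc m) f us =
    ∑ V (λ v → ∑-fresh V m f (v ∷ us)) - ∑ us (λ u → ∑-fresh V m f (u ∷ us))

  -- The chosen elements `us` and the remaining ones `U` together make up `V`, so a sum over `U` is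
  -- the sum over `V` minus the sum over `us`.
  ∑-arrangements-fresh : (V : List A) (m : ℕ) (f : List A → ℚ) (U us : List A) → U ++ us ↭ V →
    ∑ (arrangements m U) (λ ws → f (ws ʳ++ us)) ≡ ∑-fresh V m f us
  ∑-arrangements-fresh V zero    f U us U++us↭V = ℚ.+-identityʳ (f us)
  ∑-arrangements-fresh V (suc m) f U us U++us↭V = begin
    ∑ (arrangements (suc m) U) (λ ws → f (ws ʳ++ us))
      ≡⟨ ∑-arrangements-suc m U _ ⟩
    ∑ (splits U) (λ (p , u , q) → ∑ (arrangements m (p ++ q)) (λ ws → f (ws ʳ++ (u ∷ us))))
      ≡⟨ ∑-cong-All (All.map (λ { {p , u , q} refl → ∑-arrangements-fresh V m f (p ++ q) (u ∷ us)
           (↭-trans (moved p u q) U++us↭V) }) (splits-sound U)) ⟩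
    ∑ (splits U) (λ (p , u , q) → next u)
      ≡⟨ ∑-splits-mid U next ⟩
    ∑ U next
      ≡⟨ solve 2 (λ a b → a := (a :+ b) :- b) refl (∑ U next) (∑ us next) ⟩
    ∑ U next + ∑ us next - ∑ us next
      ≡⟨ cong (_- ∑ us next) (trans (sym (∑-++ U us next)) (∑-↭ next U++us↭V)) ⟩
    ∑ V next - ∑ us next ∎
    where
    open ≡-Reasoning
    next : A → ℚ
    next u = ∑-fresh V m f (u ∷ us)
    moved : ∀ p u q → (p ++ q) ++ u ∷ us ↭ (p ++ u ∷ q) ++ us
    moved p u q = ↭-trans (shift u (p ++ q) us) (++⁺ʳ us (↭-sym (shift u p q)))

-- Polynomials in one variable

*-cancelˡ-0 : ∀ {p q} → p ≢ 0ℚ → p * q ≡ 0ℚ → q ≡ 0ℚ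
*-cancelˡ-0 {p} {q} p≢0 p*q≡0 = begin
  q                ≡⟨ ℚ.*-identityˡ q ⟨
  1ℚ * q           ≡⟨ cong (_* q) (ℚ.*-inverseˡ p) ⟨
  1/ p * p * q     ≡⟨ ℚ.*-assoc (1/ p) p q ⟩
  1/ p * (p * q)   ≡⟨ cong (1/ p *_) p*q≡0 ⟩
  1/ p * 0ℚ        ≡⟨ ℚ.*-zeroʳ (1/ p) ⟩
  0ℚ               ∎
  where
  open ≡-Reasoning
  instance
    p-nonZero : ℚ.NonZero p
    p-nonZero = ℚ.≢-nonZero p≢0

fromℕ-+1 : ∀ n → fromℕ n + 1ℚ ≡ fromℕ (suc n)
fromℕ-+1 n = trans (ℚ.+-comm (fromℕ n) 1ℚ) (sym (fromℕ-suc n))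

-- Iterated forward differences replace root counting: that some order of them vanishes is all that
-- `integer-valued` and `zero-at-0` use of a polynomial.
DiffVanishes : ℕ → (ℚ → ℚ) → Set
DiffVanishes zero    f = ∀ x → f x ≡ 0ℚ
DiffVanishes (suc d) f = DiffVanishes d (λ x → f (x + 1ℚ) - f x)

DiffVanishes-cong : ∀ d {f g} → (∀ x → f x ≡ g x) → DiffVanishes d f → DiffVanishes d g
DiffVanishes-cong zero    eq v x = trans (sym (eq x)) (v x)
DiffVanishes-cong (suc d) eq v   = DiffVanishes-cong d (λ x → cong₂ _-_ (eq (x + 1ℚ)) (eq x)) v

DiffVanishes-+ : ∀ d {f g} → DiffVanishes d f → DiffVanishes d g → DiffVanishes d (λ x → f x + g x)
DiffVanishes-+ zero            vf vg x = cong₂ _+_ (vf x) (vg x)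
DiffVanishes-+ (suc d) {f} {g} vf vg   = DiffVanishes-cong d
  (λ x → solve 4 (λ a b c d → (a :- b) :+ (c :- d) := (a :+ c) :- (b :+ d)) refl
           (f (x + 1ℚ)) (f x) (g (x + 1ℚ)) (g x))
  (DiffVanishes-+ d vf vg)

DiffVanishes-suc : ∀ d {f} → DiffVanishes d f → DiffVanishes (suc d) f
DiffVanishes-suc zero    v x = cong₂ _-_ (v (x + 1ℚ)) (v x)
DiffVanishes-suc (suc d) v   = DiffVanishes-suc d v

DiffVanishes-const : ∀ d a → DiffVanishes (suc d) (λ _ → a)
DiffVanishes-const zero    a x = ℚ.+-inverseʳ a
DiffVanishes-const (suc d) a   = DiffVanishes-suc (suc d) {λ _ → a} (DiffVanishes-const d a)

DiffVanishes-x* : ∀ d {f} → DiffVanishes d f → DiffVanishes (suc d) (λ x → x * f x)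
DiffVanishes-x* zero    {f} v x = trans
  (cong₂ (λ a b → (x + 1ℚ) * a - x * b) (v (x + 1ℚ)) (v x))
  (solve 1 (λ x → (x :+ con 1ℚ) :* con 0ℚ :- x :* con 0ℚ := con 0ℚ) refl x)
DiffVanishes-x* (suc d) {f} v   = DiffVanishes-cong (suc d)
  (λ x → solve 3 (λ x a b → x :* (a :- b) :+ ((a :- b) :+ b) :=
                            (x :+ con 1ℚ) :* a :- x :* b) refl x (f (x + 1ℚ)) (f x))
  (DiffVanishes-+ (suc d) {λ x → x * (f (x + 1ℚ) - f x)} (DiffVanishes-x* d v)
    (DiffVanishes-+ (suc d) {λ x → f (x + 1ℚ) - f x} {f} (DiffVanishes-suc d v) v))

DiffVanishes-eval : ∀ p → DiffVanishes (length p) (eval p)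
DiffVanishes-eval []      x = refl
DiffVanishes-eval (a ∷ p)   =
  DiffVanishes-+ (suc (length p)) {λ _ → a} (DiffVanishes-const (length p) a)
    (DiffVanishes-x* (length p) {eval p} (DiffVanishes-eval p))

-- By induction the difference of `f` is integral on all of ℤ, so the negative integers are reached
-- by stepping down from 0. This extends a degree known only at the naturals to a
-- `NumericalPolynomial`.
integer-valued : ∀ d f → DiffVanishes d f → (∀ n → ∃ λ w → f (fromℕ n) ≡ fromℤ w) →
                 ∀ z → ∃ λ w → f (fromℤ z) ≡ fromℤ w
integer-valued zero    f v int z = ℤ.0ℤ , v (fromℤ z)
integer-valued (suc d) f v int   = onℤ
  where
  open ≡-Reasoning
  g : ℚ → ℚ
  g x = f (x + 1ℚ) - f x

  Δint : ∀ z → ∃ λ w → g (fromℤ z) ≡ fromℤ w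
  Δint = integer-valued d g v λ n →
    let w₁ , eq₁ = int (suc n)
        w₀ , eq₀ = int n
    in w₁ ℤ.- w₀ , (begin
      f (fromℕ n + 1ℚ) - f (fromℕ n)
        ≡⟨ cong (λ x → f x - f (fromℕ n)) (fromℕ-+1 n) ⟩
      f (fromℕ (suc n)) - f (fromℕ n)
        ≡⟨ cong₂ _-_ eq₁ eq₀ ⟩
      fromℤ w₁ - fromℤ w₀
        ≡⟨ cong (fromℤ w₁ +_) (fromℤ-neg w₀) ⟨
      fromℤ w₁ + fromℤ (ℤ.- w₀)
        ≡⟨ fromℤ-+ w₁ (ℤ.- w₀) ⟨
      fromℤ (w₁ ℤ.- w₀) ∎)

  neg-suc : ∀ n → fromℤ -[1+ n ] + 1ℚ ≡ fromℤ (ℤ.- (ℤ.+ n))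
  neg-suc zero    = refl
  neg-suc (suc n) = sym (fromℤ-+ -[1+ suc n ] (ℤ.+ 1))

  down : ∀ n → ∃ λ w → f (fromℤ (ℤ.- (ℤ.+ n))) ≡ fromℤ w
  down zero    = int zero
  down (suc n) =
    let w₁ , eq₁ = down n
        w₀ , eq₀ = Δint -[1+ n ]
        x = fromℤ -[1+ n ]
    in w₁ ℤ.- w₀ , (begin
      f x                           ≡⟨ solve 2 (λ a b → a := b :- (b :- a)) refl (f x) (f (x + 1ℚ)) ⟩
      f (x + 1ℚ) - g x              ≡⟨ cong₂ _-_ (trans (cong f (neg-suc n)) eq₁) eq₀ ⟩
      fromℤ w₁ - fromℤ w₀           ≡⟨ cong (fromℤ w₁ +_) (fromℤ-neg w₀) ⟨
      fromℤ w₁ + fromℤ (ℤ.- w₀)     ≡⟨ fromℤ-+ w₁ (ℤ.- w₀) ⟨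
      fromℤ (w₁ ℤ.- w₀)             ∎)

  onℤ : ∀ z → ∃ λ w → f (fromℤ z) ≡ fromℤ w
  onℤ (ℤ.+ n)  = int n
  onℤ -[1+ n ] = down (suc n)

-- The difference of `f` again vanishes at the positive integers, hence by induction at 0, and so
-- `f 0ℚ` equals `f 1ℚ`.
zero-at-0 : ∀ d f → DiffVanishes d f → (∀ n → f (fromℕ (suc n)) ≡ 0ℚ) → f 0ℚ ≡ 0ℚ
zero-at-0 zero    f v zeros = v 0ℚ
zero-at-0 (suc d) f v zeros = begin
  f 0ℚ                  ≡⟨ solve 2 (λ a b → a := b :- (b :- a)) refl (f 0ℚ) (f 1ℚ) ⟩
  f 1ℚ - (f 1ℚ - f 0ℚ)  ≡⟨ cong₂ _-_ (zeros 0) (zero-at-0 d (λ x → f (x + 1ℚ) - f x) v Δzeros) ⟩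
  0ℚ                    ∎
  where
  open ≡-Reasoning
  Δzeros : ∀ n → f (fromℕ (suc n) + 1ℚ) - f (fromℕ (suc n)) ≡ 0ℚ
  Δzeros n = cong₂ _-_
    (trans (cong f (fromℕ-+1 (suc n))) (zeros (suc n)))
    (zeros n)

-- The constant term is the value at 0. What remains is `x` times the tail; cancelling `x` loses the
-- point 0, which `zero-at-0` restores.
eval-zero⇒IsZero : ∀ p → (∀ n → eval p (fromℕ n) ≡ 0ℚ) → IsZero p
eval-zero⇒IsZero []      zeros i    = refl
eval-zero⇒IsZero (a ∷ p) zeros      = coeffs
  where
  open ≡-Reasoning
  a≡0 : a ≡ 0ℚ
  a≡0 = trans (solve 2 (λ a b → a := a :+ con 0ℚ :* b) refl a (eval p 0ℚ)) (zeros 0)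

  tail-zeros : ∀ n → eval p (fromℕ (suc n)) ≡ 0ℚ
  tail-zeros n = *-cancelˡ-0 (λ eq → ℕ.1+n≢0 (fromℕ-injective {suc n} {0} eq)) (begin
    fromℕ (suc n) * eval p (fromℕ (suc n))        ≡⟨ ℚ.+-identityˡ _ ⟨
    0ℚ + fromℕ (suc n) * eval p (fromℕ (suc n))   ≡⟨ cong (_+ _) a≡0 ⟨
    a + fromℕ (suc n) * eval p (fromℕ (suc n))    ≡⟨ zeros (suc n) ⟩
    0ℚ                                            ∎)

  coeffs : IsZero (a ∷ p)
  coeffs zero    = a≡0
  coeffs (suc i) = eval-zero⇒IsZero p
    (λ { zero → zero-at-0 (length p) (eval p) (DiffVanishes-eval p) tail-zeros
       ; (suc n) → tail-zeros n }) i

-- s 0 x^M + s 1 x^(M-1) + … + s M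
fromTop : (ℕ → ℚ) → ℕ → Poly
fromTop s zero    = s zero ∷ []
fromTop s (suc M) = s (suc M) ∷ fromTop s M

coeff-fromTop : ∀ s M r → r ℕ.≤ M → coeff (fromTop s M) (M ∸ r) ≡ s r
coeff-fromTop s zero    zero    _   = refl
coeff-fromTop s (suc M) r       r≤M with r ℕ.≟ suc M
... | yes refl = cong (coeff (fromTop s (suc M))) (ℕ.n∸n≡0 M)
... | no  r≢M  = trans
  (cong (coeff (fromTop s (suc M))) (ℕ.+-∸-assoc 1 r≤M′)) (coeff-fromTop s M r r≤M′)
  where r≤M′ = ℕ.≤-pred (ℕ.≤∧≢⇒< r≤M r≢M)

coeff-fromTop-> : ∀ s M i → M ℕ.< i → coeff (fromTop s M) i ≡ 0ℚ
coeff-fromTop-> s zero    (suc i) _           = refl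
coeff-fromTop-> s (suc M) (suc i) (ℕ.s≤s M<i) = coeff-fromTop-> s M i M<i

eval-fromTop-cong : ∀ {s t} M x → (∀ r → s r ≡ t r) →
                    eval (fromTop s M) x ≡ eval (fromTop t M) x
eval-fromTop-cong zero    x eq = cong (_+ x * 0ℚ) (eq 0)
eval-fromTop-cong (suc M) x eq =
  cong₂ (λ a b → a + x * b) (eq (suc M)) (eval-fromTop-cong M x eq)

eval-fromTop-+ : ∀ s t M x → eval (fromTop (λ r → s r + t r) M) x ≡
                             eval (fromTop s M) x + eval (fromTop t M) x
eval-fromTop-+ s t zero    x =
  solve 3 (λ a b x → a :+ b :+ x :* con 0ℚ := (a :+ x :* con 0ℚ) :+ (b :+ x :* con 0ℚ)) refl
    (s 0) (t 0) x
eval-fromTop-+ s t (suc M) x = trans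
  (cong (λ v → s (suc M) + t (suc M) + x * v) (eval-fromTop-+ s t M x))
  (solve 5 (λ a b x u v → a :+ b :+ x :* (u :+ v) := (a :+ x :* u) :+ (b :+ x :* v)) refl
    (s (suc M)) (t (suc M)) x (eval (fromTop s M) x) (eval (fromTop t M) x))

eval-fromTop-* : ∀ c s M x → eval (fromTop (λ r → c * s r) M) x ≡ c * eval (fromTop s M) x
eval-fromTop-* c s zero    x =
  solve 3 (λ c a x → c :* a :+ x :* con 0ℚ := c :* (a :+ x :* con 0ℚ)) refl c (s 0) x
eval-fromTop-* c s (suc M) x = trans
  (cong (λ v → c * s (suc M) + x * v) (eval-fromTop-* c s M x))
  (solve 4 (λ c a x u → c :* a :+ x :* (c :* u) := c :* (a :+ x :* u)) refl
    c (s (suc M)) x (eval (fromTop s M) x))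

eval-fromTop-0 : ∀ M x → eval (fromTop (λ _ → 0ℚ) M) x ≡ 0ℚ
eval-fromTop-0 M x = trans (eval-fromTop-* 0ℚ (λ _ → 0ℚ) M x)
  (ℚ.*-zeroˡ (eval (fromTop (λ _ → 0ℚ) M) x))

eval-fromTop-∑ : ∀ {B : Set} (xs : List B) (g : B → ℕ → ℚ) M x →
  eval (fromTop (λ r → ∑ xs (λ b → g b r)) M) x ≡ ∑ xs (λ b → eval (fromTop (g b) M) x)
eval-fromTop-∑ []       g M x = eval-fromTop-0 M x
eval-fromTop-∑ (b ∷ bs) g M x = trans (eval-fromTop-+ (g b) _ M x)
  (cong (eval (fromTop (g b) M) x +_) (eval-fromTop-∑ bs g M x))

fromTop-injective : ∀ s t M →
  (∀ n → eval (fromTop s M) (fromℕ n) ≡ eval (fromTop t M) (fromℕ n)) →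
  ∀ r → r ℕ.≤ M → s r ≡ t r
fromTop-injective s t M eq r r≤M = begin
  s r
    ≡⟨ solve 2 (λ a b → a := a :+ con (- 1ℚ) :* b :+ b) refl (s r) (t r) ⟩
  s r + - 1ℚ * t r + t r
    ≡⟨ cong (_+ t r) (trans (sym (coeff-fromTop d M r r≤M))
                            (eval-zero⇒IsZero (fromTop d M) d-zeros (M ∸ r))) ⟩
  0ℚ + t r
    ≡⟨ ℚ.+-identityˡ (t r) ⟩
  t r ∎
  where
  open ≡-Reasoning
  d : ℕ → ℚ
  d r = s r + - 1ℚ * t r
  d-zeros : ∀ n → eval (fromTop d M) (fromℕ n) ≡ 0ℚ
  d-zeros n = begin
    eval (fromTop d M) x
      ≡⟨ eval-fromTop-+ s (λ r → - 1ℚ * t r) M x ⟩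
    eval (fromTop s M) x + eval (fromTop (λ r → - 1ℚ * t r) M) x
      ≡⟨ cong₂ _+_ (eq n) (eval-fromTop-* (- 1ℚ) t M x) ⟩
    eval (fromTop t M) x + - 1ℚ * eval (fromTop t M) x
      ≡⟨ solve 1 (λ a → a :+ con (- 1ℚ) :* a := con 0ℚ) refl (eval (fromTop t M) x) ⟩
    0ℚ ∎
    where x = fromℕ n

-- Chromatic polynomials

ind : Bool → ℚ
ind b = if b then 1ℚ else 0ℚ

ind-∧ : ∀ b b′ → ind (b ∧ b′) ≡ ind b * ind b′
ind-∧ true  b′ = sym (ℚ.*-identityˡ (ind b′))
ind-∧ false b′ = sym (ℚ.*-zeroˡ (ind b′))

module _ {A : Set} where

  all-map : {B : Set} (f : A → Bool) (g : B → A) (xs : List B) → all f (map g xs) ≡ all (f ∘ g) xs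
  all-map f g []       = refl
  all-map f g (x ∷ xs) = cong (f (g x) ∧_) (all-map f g xs)

  all-cong : {f g : A → Bool} (xs : List A) → (∀ x → f x ≡ g x) → all f xs ≡ all g xs
  all-cong []       eq = refl
  all-cong (x ∷ xs) eq = cong₂ _∧_ (eq x) (all-cong xs eq)

  all-∧ : (f g : A → Bool) (xs : List A) → all (λ x → f x ∧ g x) xs ≡ all f xs ∧ all g xs
  all-∧ f g []       = refl
  all-∧ f g (x ∷ xs) = trans (cong ((f x ∧ g x) ∧_) (all-∧ f g xs)) (interchange (f x) (g x) _ _)

  all-↭ : (f : A → Bool) {xs ys : List A} → xs ↭ ys → all f xs ≡ all f ys
  all-↭ f refl          = refl
  all-↭ f (prep x p)    = cong (f x ∧_) (all-↭ f p)
  all-↭ f (swap x y p)  =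
    trans (cong (λ b → f x ∧ f y ∧ b) (all-↭ f p)) (x∙yz≈y∙xz (f x) (f y) _)
  all-↭ f (↭.trans p q) = trans (all-↭ f p) (all-↭ f q)

-- The vertex nothing is u after the contraction of an edge uv: its edges to
-- the vertices of q include those of v.
merge : {A : Set} → (A → A → Bool) → A → A → Maybe A → Maybe A → Bool
merge a v u (just x) (just y) = a x y
merge a v u (just x) nothing  = a x u
merge a v u nothing  (just y) = a u y ∨ a v y
merge a v u nothing  nothing  = false

insert : {A : Set} → List A → List A → List (Maybe A)
insert p q = map just p ++ nothing ∷ map just q

-- chromCoeff r a U is the coefficient of n^(|U| − r) in the chromatic polynomial
-- of the graph with vertices U and edges a.
chromCoeff : ℕ → {A : Set} → (A → A → Bool) → List A → ℚ
chromCoeff zero    a U       = 1ℚ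
chromCoeff (suc r) a []      = 0ℚ
chromCoeff (suc r) a (v ∷ U) = chromCoeff (suc r) a U -
  ∑ (splits U) (λ (p , u , q) → ind (a v u) * chromCoeff r (merge a v u) (insert p q))

-- A difference in `v` leaves minus the sum over the neighbours of `v`. Its terms have split degree
-- below `2r + 1` by induction; summing over splits adds one and the difference already taken
-- another, giving `2(r + 1) + 1`. The induction passes through the asymmetric relations
-- `merge a v u`.
Degree<-chromCoeff : ∀ r {A : Set} (a : A → A → Bool) →
                     Degree< (suc (r ℕ.* 2)) (chromCoeff r a)
Degree<-chromCoeff zero    a v U = refl
Degree<-chromCoeff (suc r) {A} a v = Degree<-cong (suc D) {λ U → - f U}
  (λ U → solve 2 (λ x y → :- y := x :- y :- x) refl (chromCoeff (suc r) a U) (f U))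
  (Degree<-neg (suc D) {f} (Degree<-splits D g (λ u →
    SplitDegree<-* D (ind (a v u)) {λ p q → chromCoeff r (merge a v u) (insert p q)}
      (SplitDegree<-insert D {chromCoeff r (merge a v u)} (Degree<-chromCoeff r (merge a v u))))))
  where
  D : ℕ
  D = suc (r ℕ.* 2)
  g : List A → A → List A → ℚ
  g p u q = ind (a v u) * chromCoeff r (merge a v u) (insert p q)
  f : List A → ℚ
  f U = ∑ (splits U) (λ (p , u , q) → g p u q)

module _ {A : Set} where

  length-insert : (U : List A) → All (λ (p , u , q) → length (insert p q) ≡ length U) (splits U)
  length-insert U = All.map (λ { {p , u , q} refl → begin
      length (insert p q)                              ≡⟨ length-++ (map just p) ⟩
      length (map just p) ℕ.+ suc (length (map just q))
        ≡⟨ cong₂ (λ m n → m ℕ.+ suc n) (length-map just p) (length-map just q) ⟩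
      length p ℕ.+ suc (length q)                      ≡⟨ length-++ p ⟨
      length (p ++ u ∷ q)                              ∎ }) (splits-sound U)
    where open ≡-Reasoning

-- Each `insert p q` is as long as `U`, one less than `v ∷ U`, while its index has also dropped by
-- one.
chromCoeff-vanish : ∀ r {A : Set} (a : A → A → Bool) U → length U ℕ.< r → chromCoeff r a U ≡ 0ℚ
chromCoeff-vanish (suc r) a []      _            = refl
chromCoeff-vanish (suc r) a (v ∷ U) (ℕ.s≤s |U|<r) = begin
  chromCoeff (suc r) a U - ∑ (splits U) (λ (p , u , q) → c p u q)
    ≡⟨ cong₂ _-_ (chromCoeff-vanish (suc r) a U (ℕ.m≤n⇒m≤1+n |U|<r))
         (trans (∑-cong-All (All.map (λ { {p , u , q} eq →
           trans (cong (ind (a v u) *_) (chromCoeff-vanish r (merge a v u) (insert p q)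
                   (subst (ℕ._< r) (sym eq) |U|<r)))
                 (ℚ.*-zeroʳ (ind (a v u))) })
             (length-insert U)))
           (∑-zero (splits U) (λ _ → refl))) ⟩
  0ℚ ∎
  where
  open ≡-Reasoning
  c : _ → _ → _ → ℚ
  c p u q = ind (a v u) * chromCoeff r (merge a v u) (insert p q)

insert-map : {A B : Set} (f : A → B) (p q : List A) →
             insert (map f p) (map f q) ≡ map (Maybe.map f) (insert p q)
insert-map f p q = begin
  map just (map f p) ++ nothing ∷ map just (map f q)
    ≡⟨ cong₂ (λ x y → x ++ nothing ∷ y) (commute p) (commute q) ⟩
  map (Maybe.map f) (map just p) ++ nothing ∷ map (Maybe.map f) (map just q)
    ≡⟨ map-++ (Maybe.map f) (map just p) _ ⟨
  map (Maybe.map f) (insert p q) ∎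
  where
  open ≡-Reasoning
  commute : ∀ xs → map just (map f xs) ≡ map (Maybe.map f) (map just xs)
  commute xs = trans (sym (map-∘ xs)) (map-∘ xs)

∑-splits-map : {A B : Set} (f : A → B) (U : List A) (g : List B × B × List B → ℚ) →
  ∑ (splits (map f U)) g ≡ ∑ (splits U) (λ (p , u , q) → g (map f p , f u , map f q))
∑-splits-map f []      g = refl
∑-splits-map f (v ∷ U) g = begin
  ∑ (splits (f v ∷ map f U)) g
    ≡⟨ ∑-splits-∷ (f v) (map f U) g ⟩
  g ([] , f v , map f U) + ∑ (splits (map f U)) (λ (p , u , q) → g (f v ∷ p , u , q))
    ≡⟨ cong (g ([] , f v , map f U) +_) (∑-splits-map f U _) ⟩
  g ([] , f v , map f U) + ∑ (splits U) (λ (p , u , q) → g (f v ∷ map f p , f u , map f q))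
    ≡⟨ ∑-splits-∷ v U (λ (p , u , q) → g (map f p , f u , map f q)) ⟨
  ∑ (splits (v ∷ U)) (λ (p , u , q) → g (map f p , f u , map f q)) ∎
  where open ≡-Reasoning

-- Only the adjacencies pulled back along `f` enter the recursion. This covers non-injective `f`
-- too, as arises from tuples with repeated vertices.
chromCoeff-map : ∀ r {A B : Set} {a : A → A → Bool} {b : B → B → Bool} (f : A → B) →
  (∀ x y → b (f x) (f y) ≡ a x y) → ∀ U → chromCoeff r b (map f U) ≡ chromCoeff r a U
chromCoeff-map zero    f eq U       = refl
chromCoeff-map (suc r) f eq []      = refl
chromCoeff-map (suc r) {a = a} {b} f eq (v ∷ U) = cong₂ _-_ (chromCoeff-map (suc r) f eq U)
  (trans (∑-splits-map f U _) (∑-cong (splits U) (λ (p , u , q) →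
    cong₂ _*_ (cong ind (eq v u))
      (trans (cong (chromCoeff r (merge b (f v) (f u))) (insert-map f p q))
             (chromCoeff-map r (Maybe.map f) (merge-map u) (insert p q))))))
  where
  merge-map : ∀ u x y → merge b (f v) (f u) (Maybe.map f x) (Maybe.map f y) ≡ merge a v u x y
  merge-map u (just x) (just y) = eq x y
  merge-map u (just x) nothing  = eq x u
  merge-map u nothing  (just y) = cong₂ _∨_ (eq u y) (eq v y)
  merge-map u nothing  nothing  = refl

-- Proper colourings and their recursion on the first vertex

colourings : {A C : Set} → List C → List A → List (List (A × C))
colourings cs []      = [] ∷ []
colourings cs (v ∷ U) = concatMap (λ y → map ((v , y) ∷_) (colourings cs U)) cs

module _ {A C : Set} where

  module _ (a : A → A → Bool) (ne : C → C → Bool) where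

    compatible : A × C → A × C → Bool
    compatible (v , y) (u , z) = not (a v u) ∨ ne y z

    -- Each pair is tested once, with the earlier entry first. An asymmetric relation such as
    -- `merge` can therefore prescribe different edges towards earlier and later vertices.
    proper : List (A × C) → Bool
    proper []       = true
    proper (x ∷ xs) = all (compatible x) xs ∧ proper xs

  colouringCount : (A → A → Bool) → (C → C → Bool) → List C → List A → ℚ
  colouringCount a ne cs U = ∑ (colourings cs U) (ind ∘ proper a ne)

  ∑-colourings-∷ : (cs : List C) (v : A) (U : List A) (f : List (A × C) → ℚ) →
    ∑ (colourings cs (v ∷ U)) f ≡ ∑ cs (λ y → ∑ (colourings cs U) (f ∘ ((v , y) ∷_)))
  ∑-colourings-∷ cs v U f = trans
    (∑-concatMap (λ y → map ((v , y) ∷_) (colourings cs U)) cs f)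
    (∑-cong cs (λ y → ∑-map ((v , y) ∷_) (colourings cs U) f))

  ∑-colourings-++ : (cs : List C) (U W : List A) (f : List (A × C) → ℚ) →
    ∑ (colourings cs (U ++ W)) f ≡
    ∑ (colourings cs U) (λ ps → ∑ (colourings cs W) (λ qs → f (ps ++ qs)))
  ∑-colourings-++ cs []      W f = sym (ℚ.+-identityʳ _)
  ∑-colourings-++ cs (v ∷ U) W f = begin
    ∑ (colourings cs (v ∷ U ++ W)) f
      ≡⟨ ∑-colourings-∷ cs v (U ++ W) f ⟩
    ∑ cs (λ y → ∑ (colourings cs (U ++ W)) (f ∘ ((v , y) ∷_)))
      ≡⟨ ∑-cong cs (λ y → ∑-colourings-++ cs U W (f ∘ ((v , y) ∷_))) ⟩
    ∑ cs (λ y → ∑ (colourings cs U) (λ ps → ∑ (colourings cs W) (λ qs → f ((v , y) ∷ ps ++ qs))))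
      ≡⟨ ∑-colourings-∷ cs v U _ ⟨
    ∑ (colourings cs (v ∷ U)) (λ ps → ∑ (colourings cs W) (λ qs → f (ps ++ qs))) ∎
    where open ≡-Reasoning

  ∑-colourings-splits : (cs : List C) (U : List A)
    (g : List (A × C) × (A × C) × List (A × C) → ℚ) →
    ∑ (colourings cs U) (λ ps → ∑ (splits ps) g) ≡
    ∑ (splits U) (λ (p , u , q) → ∑ (colourings cs p) (λ ps → ∑ cs (λ z →
      ∑ (colourings cs q) (λ qs → g (ps , (u , z) , qs)))))
  ∑-colourings-splits cs []      g = refl
  ∑-colourings-splits cs (v ∷ U) g = begin
    ∑ (colourings cs (v ∷ U)) (λ ps → ∑ (splits ps) g)
      ≡⟨ ∑-colourings-∷ cs v U _ ⟩
    ∑ cs (λ y → ∑ (colourings cs U) (λ ps → ∑ (splits ((v , y) ∷ ps)) g))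
      ≡⟨ ∑-cong cs (λ y → trans
           (∑-cong (colourings cs U) (λ ps → ∑-splits-∷ (v , y) ps g))
           (∑-+ (colourings cs U) (λ ps → g ([] , (v , y) , ps)) _)) ⟩
    ∑ cs (λ y → first y + ∑ (colourings cs U) (λ ps → ∑ (splits ps) (later y)))
      ≡⟨ ∑-+ cs first _ ⟩
    ∑ cs first + ∑ cs (λ y → ∑ (colourings cs U) (λ ps → ∑ (splits ps) (later y)))
      ≡⟨ cong₂ _+_ (ℚ.+-identityʳ (∑ cs first))
           (trans (∑-swap (splits U) cs _)
             (∑-cong cs (λ y → sym (∑-colourings-splits cs U (later y))))) ⟨
    ∑ (colourings cs []) (λ ps → ∑ cs (λ z → ∑ (colourings cs U) (λ qs → g (ps , (v , z) , qs)))) +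
    ∑ (splits U) (λ (p , u , q) → ∑ cs (λ y → ∑ (colourings cs p) (λ ps → ∑ cs (λ z →
      ∑ (colourings cs q) (λ qs → later y (ps , (u , z) , qs))))))
      ≡⟨ cong (∑ (colourings cs []) (λ ps → ∑ cs (λ z → ∑ (colourings cs U) (λ qs → g (ps , (v , z) , qs)))) +_)
           (∑-cong (splits U) (λ (p , u , q) → ∑-colourings-∷ cs v p _)) ⟨
    _ ≡⟨ ∑-splits-∷ v U (λ (p , u , q) → ∑ (colourings cs p) (λ ps → ∑ cs (λ z →
           ∑ (colourings cs q) (λ qs → g (ps , (u , z) , qs))))) ⟨
    ∑ (splits (v ∷ U)) (λ (p , u , q) → ∑ (colourings cs p) (λ ps → ∑ cs (λ z →
      ∑ (colourings cs q) (λ qs → g (ps , (u , z) , qs))))) ∎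
    where
    open ≡-Reasoning
    first : C → ℚ
    first y = ∑ (colourings cs U) (λ ps → g ([] , (v , y) , ps))
    later : C → List (A × C) × (A × C) × List (A × C) → ℚ
    later y (ps , x , qs) = g ((v , y) ∷ ps , x , qs)

∑-colourings-map : {A B C : Set} (g : A → B) (cs : List C) (U : List A) (f : List (B × C) → ℚ) →
  ∑ (colourings cs (map g U)) f ≡ ∑ (colourings cs U) (f ∘ map (map₁ g))
∑-colourings-map g cs []      f = refl
∑-colourings-map g cs (v ∷ U) f = trans (∑-colourings-∷ cs (g v) (map g U) f)
  (trans (∑-cong cs (λ y → ∑-colourings-map g cs U (f ∘ ((g v , y) ∷_))))
         (sym (∑-colourings-∷ cs v U (f ∘ map (map₁ g)))))

module _ {A C : Set} where

  private
    embed : List (A × C) → List (Maybe A × C)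
    embed = map (map₁ just)

  ∑-colourings-insert : (cs : List C) (p q : List A) (f : List (Maybe A × C) → ℚ) →
    ∑ (colourings cs (insert p q)) f ≡
    ∑ (colourings cs p) (λ ps → ∑ cs (λ z →
      ∑ (colourings cs q) (λ qs → f (embed ps ++ (nothing , z) ∷ embed qs))))
  ∑-colourings-insert cs p q f = begin
    ∑ (colourings cs (insert p q)) f
      ≡⟨ ∑-colourings-++ cs (map just p) (nothing ∷ map just q) f ⟩
    ∑ (colourings cs (map just p)) (λ ps → ∑ (colourings cs (nothing ∷ map just q)) (λ qs → f (ps ++ qs)))
      ≡⟨ ∑-colourings-map just cs p _ ⟩
    ∑ (colourings cs p) (λ ps →
      ∑ (colourings cs (nothing ∷ map just q)) (λ qs → f (embed ps ++ qs)))
      ≡⟨ ∑-cong (colourings cs p) (λ ps → trans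
           (∑-colourings-∷ cs nothing (map just q) _)
           (∑-cong cs (λ z → ∑-colourings-map just cs q _))) ⟩
    ∑ (colourings cs p) (λ ps → ∑ cs (λ z →
      ∑ (colourings cs q) (λ qs → f (embed ps ++ (nothing , z) ∷ embed qs)))) ∎
    where open ≡-Reasoning

  module _ (a : A → A → Bool) (ne : C → C → Bool) (v u : A) (z : C) where

    private
      a′ = merge a v u

    proper-embed : (xs : List (A × C)) → proper a′ ne (embed xs) ≡ proper a ne xs
    proper-embed []       = refl
    proper-embed (x ∷ xs) = cong₂ _∧_ (all-map _ _ xs) (proper-embed xs)

    compatible-merge : ∀ x → compatible a′ ne (nothing , z) (map₁ just x) ≡
                             compatible a ne (u , z) x ∧ compatible a ne (v , z) x
    compatible-merge (w , t) = lemma (a u w) (a v w) (ne z t)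
      where
      lemma : ∀ b c d → not (b ∨ c) ∨ d ≡ (not b ∨ d) ∧ (not c ∨ d)
      lemma true  true  true  = refl
      lemma true  true  false = refl
      lemma true  false true  = refl
      lemma true  false false = refl
      lemma false true  d     = refl
      lemma false false d     = refl

    -- The colour `z` must respect the edges of `u` towards both `ps` and `qs`, and those of `v`
    -- towards `qs` alone; these are the edges that `merge` gives to `nothing`.
    proper-merge : ∀ ps qs →
      proper a ne (ps ++ (u , z) ∷ qs) ∧ all (compatible a ne (v , z)) qs ≡
      proper a′ ne (embed ps ++ (nothing , z) ∷ embed qs)
    proper-merge [] qs = begin
      (all (compatible a ne (u , z)) qs ∧ proper a ne qs) ∧ all (compatible a ne (v , z)) qs
        ≡⟨ xy∙z≈xz∙y (all (compatible a ne (u , z)) qs) _ _ ⟩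
      (all (compatible a ne (u , z)) qs ∧ all (compatible a ne (v , z)) qs) ∧ proper a ne qs
        ≡⟨ cong₂ _∧_ (trans (all-map _ _ qs)
             (trans (all-cong qs compatible-merge) (all-∧ _ _ qs))) (proper-embed qs) ⟨
      all (compatible a′ ne (nothing , z)) (embed qs) ∧ proper a′ ne (embed qs) ∎
      where open ≡-Reasoning
    proper-merge (x ∷ ps) qs = trans (∧-assoc (all (compatible a ne x) (ps ++ (u , z) ∷ qs)) _ _)
      (cong₂ _∧_ (all-embed ps) (proper-merge ps qs))
      where
      all-embed : ∀ ps → all (compatible a ne x) (ps ++ (u , z) ∷ qs) ≡
        all (compatible a′ ne (map₁ just x)) (embed ps ++ (nothing , z) ∷ embed qs)
      all-embed []       = cong (compatible a ne x (u , z) ∧_) (sym (all-map _ _ qs))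
      all-embed (y ∷ ps) = cong (compatible a ne x y ∧_) (all-embed ps)

  -- Each colour used on a neighbour of v is counted at its last occurrence.
  module _ (ne : C → C → Bool) (cs : List C)
           (separated : ∀ (f : C → ℚ) z → ∑ cs (λ y → (1ℚ - ind (ne y z)) * f y) ≡ f z) where

    ∑-compatible : (a : A → A → Bool) (v : A) (ps : List (A × C)) →
      ∑ cs (λ y → ind (all (compatible a ne (v , y)) ps)) ≡
      ∑ cs (λ _ → 1ℚ) -
      ∑ (splits ps) (λ (p , (u , z) , q) → ind (a v u) * ind (all (compatible a ne (v , z)) q))
    ∑-compatible a v []             = sym (ℚ.+-identityʳ _)
    ∑-compatible a v ((u , z) ∷ ps) = begin
      ∑ cs (λ y → ind ((not (a v u) ∨ ne y z) ∧ all (compatible a ne (v , y)) ps))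
        -- The entry `(u , z)` newly forbids at most the colour `z`: it does so if `u` is adjacent
        -- to `v` and `ps` still allows `z`.
        ≡⟨ ∑-cong cs (λ y → trans (ind-∧ (not (a v u) ∨ ne y z) _)
             (expand (a v u) (ne y z) (b y))) ⟩
      ∑ cs (λ y → b y - ind (a v u) * ((1ℚ - ind (ne y z)) * b y))
        ≡⟨ ∑-- cs b _ ⟩
      ∑ cs b - ∑ cs (λ y → ind (a v u) * ((1ℚ - ind (ne y z)) * b y))
        ≡⟨ cong₂ _-_ (∑-compatible a v ps)
             (trans (∑-* cs (ind (a v u)) _) (cong (ind (a v u) *_) (separated b z))) ⟩
      ∑ cs (λ _ → 1ℚ) - ∑ (splits ps) g - ind (a v u) * b z
        ≡⟨ solve 3 (λ x y w → x :- y :- w := x :- (w :+ y)) refl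
             (∑ cs (λ _ → 1ℚ)) (∑ (splits ps) g) (ind (a v u) * b z) ⟩
      ∑ cs (λ _ → 1ℚ) - (ind (a v u) * b z + ∑ (splits ps) g)
        ≡⟨ cong (λ x → ∑ cs (λ _ → 1ℚ) - x) (∑-splits-∷ (u , z) ps g) ⟨
      ∑ cs (λ _ → 1ℚ) - ∑ (splits ((u , z) ∷ ps)) g ∎
      where
      open ≡-Reasoning
      b : C → ℚ
      b y = ind (all (compatible a ne (v , y)) ps)
      g : List (A × C) × (A × C) × List (A × C) → ℚ
      g (p , (u , z) , q) = ind (a v u) * ind (all (compatible a ne (v , z)) q)
      expand : ∀ d e x → ind (not d ∨ e) * x ≡ x - ind d * ((1ℚ - ind e) * x)
      expand true  true  x = solve 1 (λ x → con 1ℚ :* x := x :- con 1ℚ :* ((con 1ℚ :- con 1ℚ) :* x)) refl x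
      expand true  false x = solve 1 (λ x → con 0ℚ :* x := x :- con 1ℚ :* ((con 1ℚ :- con 0ℚ) :* x)) refl x
      expand false e     x = solve 2 (λ e x → con 1ℚ :* x := x :- con 0ℚ :* ((con 1ℚ :- e) :* x)) refl (ind e) x

    -- With a colouring of `U` fixed, `∑-compatible` counts the colours left for `v`. In the term
    -- subtracted at `u`, the condition that no later neighbour of `v` has the colour of `u` merges
    -- with properness into properness for `merge a v u`.
    colouringCount-∷ : (a : A → A → Bool) (v : A) (U : List A) →
      colouringCount a ne cs (v ∷ U) ≡
      ∑ cs (λ _ → 1ℚ) * colouringCount a ne cs U -
      ∑ (splits U) (λ (p , u , q) →
        ind (a v u) * colouringCount (merge a v u) ne cs (insert p q))
    colouringCount-∷ a v U = begin
      colouringCount a ne cs (v ∷ U)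
        ≡⟨ ∑-colourings-∷ cs v U _ ⟩
      ∑ cs (λ y → ∑ (colourings cs U) (λ ps → ind (free y ps ∧ proper a ne ps)))
        ≡⟨ ∑-swap cs (colourings cs U) _ ⟩
      ∑ (colourings cs U) (λ ps → ∑ cs (λ y → ind (free y ps ∧ proper a ne ps)))
        ≡⟨ ∑-cong (colourings cs U) (λ ps → trans
             (∑-cong cs (λ y → trans (ind-∧ (free y ps) _) (ℚ.*-comm (ind (free y ps)) _)))
             (trans (∑-* cs (π ps) (λ y → ind (free y ps)))
                    (cong (π ps *_) (∑-compatible a v ps)))) ⟩
      ∑ (colourings cs U) (λ ps → π ps * (N - ∑ (splits ps) g))
        ≡⟨ ∑-cong (colourings cs U) (λ ps →
             solve 3 (λ x y z → x :* (y :- z) := y :* x :- x :* z) refl (π ps) N (∑ (splits ps) g)) ⟩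
      ∑ (colourings cs U) (λ ps → N * π ps - π ps * ∑ (splits ps) g)
        ≡⟨ ∑-- (colourings cs U) (λ ps → N * π ps) _ ⟩
      ∑ (colourings cs U) (λ ps → N * π ps) - ∑ (colourings cs U) (λ ps → π ps * ∑ (splits ps) g)
        ≡⟨ cong₂ _-_ (∑-* (colourings cs U) N π)
             (trans (∑-cong (colourings cs U) distribute)
               (trans (∑-colourings-splits cs U h) (∑-cong (splits U) contract))) ⟩
      N * colouringCount a ne cs U -
      ∑ (splits U) (λ (p , u , q) →
        ind (a v u) * colouringCount (merge a v u) ne cs (insert p q)) ∎
      where
      open ≡-Reasoning
      N : ℚ
      N = ∑ cs (λ _ → 1ℚ)
      free : C → List (A × C) → Bool
      free y = all (compatible a ne (v , y))
      π : List (A × C) → ℚ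
      π ps = ind (proper a ne ps)
      g h : List (A × C) × (A × C) × List (A × C) → ℚ
      g (p , (u , z) , q) = ind (a v u) * ind (free z q)
      h (p , (u , z) , q) = ind (a v u) * ind (proper a ne (p ++ (u , z) ∷ q) ∧ free z q)
      distribute : ∀ ps → π ps * ∑ (splits ps) g ≡ ∑ (splits ps) h
      distribute ps = trans (sym (∑-* (splits ps) (π ps) g))
        (∑-cong-All (All.map (λ { {p , (u , z) , q} refl → trans
            (solve 3 (λ x y z → x :* (y :* z) := y :* (x :* z)) refl
              (π (p ++ (u , z) ∷ q)) (ind (a v u)) (ind (free z q)))
            (cong (ind (a v u) *_) (sym (ind-∧ (proper a ne (p ++ (u , z) ∷ q)) _))) })
          (splits-sound ps)))
      contract : ((p , u , q) : List A × A × List A) →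
        ∑ (colourings cs p) (λ ps → ∑ cs (λ z →
          ∑ (colourings cs q) (λ qs → h (ps , (u , z) , qs)))) ≡
        ind (a v u) * colouringCount (merge a v u) ne cs (insert p q)
      contract (p , u , q) = begin
        ∑ (colourings cs p) (λ ps → ∑ cs (λ z → ∑ (colourings cs q) (λ qs → h (ps , (u , z) , qs))))
          ≡⟨ ∑-cong (colourings cs p) (λ ps → trans
               (∑-cong cs (λ z → trans
                 (∑-* (colourings cs q) (ind (a v u)) _)
                 (cong (ind (a v u) *_) (∑-cong (colourings cs q) (λ qs →
                   cong ind (proper-merge a ne v u z ps qs))))))
               (∑-* cs (ind (a v u)) _)) ⟩
        ∑ (colourings cs p) (λ ps → ind (a v u) * ∑ cs (λ z → ∑ (colourings cs q) (λ qs →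
          ind (proper (merge a v u) ne (embed ps ++ (nothing , z) ∷ embed qs)))))
          ≡⟨ ∑-* (colourings cs p) (ind (a v u)) _ ⟩
        ind (a v u) * ∑ (colourings cs p) (λ ps → ∑ cs (λ z → ∑ (colourings cs q) (λ qs →
          ind (proper (merge a v u) ne (embed ps ++ (nothing , z) ∷ embed qs)))))
          ≡⟨ cong (ind (a v u) *_) (∑-colourings-insert cs p q _) ⟨
        ind (a v u) * colouringCount (merge a v u) ne cs (insert p q) ∎

-- The polynomial of `t` is raised by a factor `x`, with `t (suc M)` as the new constant term; `w`
-- enters one place later, so its polynomial keeps degree bound `M`.
eval-fromTop-step : ∀ {s t w : ℕ → ℚ} M x → s 0 ≡ t 0 → (∀ r → s (suc r) ≡ t (suc r) - w r) →
  eval (fromTop s (suc M)) x ≡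
  t (suc M) + x * eval (fromTop t M) x - eval (fromTop w M) x
eval-fromTop-step {s} {t} {w} zero    x eq₀ eq = trans
  (cong₂ (λ a b → a + x * (b + x * 0ℚ)) (eq 0) eq₀)
  (solve 4 (λ a b c x → a :- c :+ x :* (b :+ x :* con 0ℚ) :=
                        a :+ x :* (b :+ x :* con 0ℚ) :- (c :+ x :* con 0ℚ)) refl
    (t 1) (t 0) (w 0) x)
eval-fromTop-step {s} {t} {w} (suc M) x eq₀ eq = trans
  (cong₂ (λ a b → a + x * b) (eq (suc M)) (eval-fromTop-step {s} {t} {w} M x eq₀ eq))
  (solve 6 (λ a c x b u v → a :- c :+ x :* (b :+ x :* u :- v) :=
                            a :+ x :* (b :+ x :* u) :- (c :+ x :* v)) refl
    (t (suc (suc M))) (w (suc M)) x (t (suc M)) (eval (fromTop t M) x) (eval (fromTop w M) x))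

module _ {C : Set} (ne : C → C → Bool) (cs : List C)
         (separated : ∀ (f : C → ℚ) z → ∑ cs (λ y → (1ℚ - ind (ne y z)) * f y) ≡ f z) where

  private
    N : ℚ
    N = ∑ cs (λ _ → 1ℚ)

  colouringCount-polynomial : ∀ M {A : Set} (a : A → A → Bool) U → length U ≡ M →
    colouringCount a ne cs U ≡ eval (fromTop (λ r → chromCoeff r a U) M) N
  colouringCount-polynomial zero    a []      eq = cong (1ℚ +_) (sym (ℚ.*-zeroʳ N))
  colouringCount-polynomial (suc M) {A} a (v ∷ U) eq = begin
    colouringCount a ne cs (v ∷ U)
      ≡⟨ colouringCount-∷ ne cs separated a v U ⟩
    N * colouringCount a ne cs U -
    ∑ (splits U) (λ (p , u , q) → ind (a v u) * colouringCount (merge a v u) ne cs (insert p q))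
      ≡⟨ cong₂ _-_ (cong (N *_) (colouringCount-polynomial M a U |U|≡M))
           (∑-cong-All (All.map (λ { {p , u , q} eq′ → trans
             (cong (ind (a v u) *_)
               (colouringCount-polynomial M (merge a v u) (insert p q) (trans eq′ |U|≡M)))
             (sym (eval-fromTop-* (ind (a v u)) _ M N)) })
             (length-insert U))) ⟩
    N * eval (fromTop t M) N - ∑ (splits U) (λ x → eval (fromTop (g x) M) N)
      ≡⟨ cong (λ x → N * eval (fromTop t M) N - x) (eval-fromTop-∑ (splits U) g M N) ⟨
    N * eval (fromTop t M) N - eval (fromTop w M) N
      ≡⟨ cong (_- eval (fromTop w M) N) (ℚ.+-identityˡ (N * eval (fromTop t M) N)) ⟨
    0ℚ + N * eval (fromTop t M) N - eval (fromTop w M) N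
      ≡⟨ cong (λ x → x + N * eval (fromTop t M) N - eval (fromTop w M) N)
           (chromCoeff-vanish (suc M) a U (ℕ.s≤s (ℕ.≤-reflexive |U|≡M))) ⟨
    t (suc M) + N * eval (fromTop t M) N - eval (fromTop w M) N
      ≡⟨ eval-fromTop-step {λ r → chromCoeff r a (v ∷ U)} {t} {w} M N refl (λ r → refl) ⟨
    eval (fromTop (λ r → chromCoeff r a (v ∷ U)) (suc M)) N ∎
    where
    open ≡-Reasoning
    |U|≡M : length U ≡ M
    |U|≡M = ℕ.suc-injective eq
    t w : ℕ → ℚ
    t r = chromCoeff r a U
    g : List A × A × List A → ℕ → ℚ
    g (p , u , q) r = ind (a v u) * chromCoeff r (merge a v u) (insert p q)
    w r = ∑ (splits U) (λ x → g x r)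

-- Independence of the order of the vertices

module _ {A C : Set} (a : A → A → Bool) (a-sym : ∀ u v → a u v ≡ a v u)
         (ne : C → C → Bool) (ne-sym : ∀ y z → ne y z ≡ ne z y) where

  proper-↭ : ∀ {xs ys} → xs ↭ ys → proper a ne xs ≡ proper a ne ys
  proper-↭ refl                  = refl
  proper-↭ (prep x p)            = cong₂ _∧_ (all-↭ (compatible a ne x) p) (proper-↭ p)
  proper-↭ (swap {xs} {ys} x@(u , y) x′@(v , z) p) = begin
    (compatible a ne x x′ ∧ all (compatible a ne x) xs) ∧
    (all (compatible a ne x′) xs ∧ proper a ne xs)
      ≡⟨ cong₂ (λ b c → (compatible a ne x x′ ∧ b) ∧ c) (all-↭ (compatible a ne x) p)
           (cong₂ _∧_ (all-↭ (compatible a ne x′) p) (proper-↭ p)) ⟩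
    (compatible a ne x x′ ∧ all (compatible a ne x) ys) ∧
    (all (compatible a ne x′) ys ∧ proper a ne ys)
      ≡⟨ cong (λ b → (b ∧ all (compatible a ne x) ys) ∧ _)
           (cong₂ (λ b c → not b ∨ c) (a-sym u v) (ne-sym y z)) ⟩
    (compatible a ne x′ x ∧ all (compatible a ne x) ys) ∧
    (all (compatible a ne x′) ys ∧ proper a ne ys)
      ≡⟨ interchange (compatible a ne x′ x) (all (compatible a ne x) ys) _ _ ⟩
    (compatible a ne x′ x ∧ all (compatible a ne x′) ys) ∧
    (all (compatible a ne x) ys ∧ proper a ne ys) ∎
    where open ≡-Reasoning
  proper-↭ (↭.trans p q)         = trans (proper-↭ p) (proper-↭ q)

∑-colourings-↭ : {A C : Set} (cs : List C) {U W : List A} {f : List (A × C) → ℚ} →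
  Symmetric f → U ↭ W → ∑ (colourings cs U) f ≡ ∑ (colourings cs W) f
∑-colourings-↭ cs f-sym refl = refl
∑-colourings-↭ cs {f = f} f-sym (prep {xs} {ys} v p) = begin
  ∑ (colourings cs (v ∷ xs)) f                        ≡⟨ ∑-colourings-∷ cs v xs f ⟩
  ∑ cs (λ y → ∑ (colourings cs xs) (f ∘ ((v , y) ∷_)))
    ≡⟨ ∑-cong cs (λ y → ∑-colourings-↭ cs (λ q → f-sym (prep _ q)) p) ⟩
  ∑ cs (λ y → ∑ (colourings cs ys) (f ∘ ((v , y) ∷_))) ≡⟨ ∑-colourings-∷ cs v ys f ⟨
  ∑ (colourings cs (v ∷ ys)) f                        ∎
  where open ≡-Reasoning
∑-colourings-↭ cs {f = f} f-sym (swap {xs} {ys} u v p) = begin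
  ∑ (colourings cs (u ∷ v ∷ xs)) f
    ≡⟨ both u v xs ⟩
  ∑ cs (λ y → ∑ cs (λ z → ∑ (colourings cs xs) (λ ps → f ((u , y) ∷ (v , z) ∷ ps))))
    ≡⟨ ∑-swap cs cs _ ⟩
  ∑ cs (λ z → ∑ cs (λ y → ∑ (colourings cs xs) (λ ps → f ((u , y) ∷ (v , z) ∷ ps))))
    ≡⟨ ∑-cong cs (λ z → ∑-cong cs (λ y → trans
         (∑-cong (colourings cs xs) (λ ps → f-sym (swap (u , y) (v , z) refl)))
         (∑-colourings-↭ cs (λ q → f-sym (prep _ (prep _ q))) p))) ⟩
  ∑ cs (λ z → ∑ cs (λ y → ∑ (colourings cs ys) (λ ps → f ((v , z) ∷ (u , y) ∷ ps))))
    ≡⟨ both v u ys ⟨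
  ∑ (colourings cs (v ∷ u ∷ ys)) f ∎
  where
  open ≡-Reasoning
  both : ∀ u v xs → ∑ (colourings cs (u ∷ v ∷ xs)) f ≡
    ∑ cs (λ y → ∑ cs (λ z → ∑ (colourings cs xs) (λ ps → f ((u , y) ∷ (v , z) ∷ ps))))
  both u v xs = trans (∑-colourings-∷ cs u (v ∷ xs) f)
    (∑-cong cs (λ y → ∑-colourings-∷ cs v xs (f ∘ ((u , y) ∷_))))
∑-colourings-↭ cs f-sym (↭.trans p q) =
  trans (∑-colourings-↭ cs f-sym p) (∑-colourings-↭ cs f-sym q)

differ : ∀ {n} → Fin n → Fin n → Bool
differ y z = not (does (y Fin.≟ z))

differ-sym : ∀ {n} (y z : Fin n) → differ y z ≡ differ z y
differ-sym zero    zero    = refl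
differ-sym zero    (suc z) = refl
differ-sym (suc y) zero    = refl
differ-sym (suc y) (suc z) = differ-sym y z

∑-allFin-suc : ∀ n (f : Fin (suc n) → ℚ) →
               ∑ (allFin (suc n)) f ≡ f zero + ∑ (allFin n) (f ∘ suc)
∑-allFin-suc n f = cong (f zero +_) (trans
  (cong (λ xs → ∑ xs f) (sym (map-tabulate id suc))) (∑-map suc (allFin n) f))

∑-allFin-1 : ∀ n → ∑ (allFin n) (λ _ → 1ℚ) ≡ fromℕ n
∑-allFin-1 zero    = refl
∑-allFin-1 (suc n) = trans (∑-allFin-suc n (λ _ → 1ℚ))
  (trans (cong (1ℚ +_) (∑-allFin-1 n)) (sym (fromℕ-suc n)))

-- The factor `1ℚ - ind (differ y z)` is the Kronecker delta, and `allFin n` lists each colour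
-- exactly once.
differ-separated : ∀ n (f : Fin n → ℚ) z →
                   ∑ (allFin n) (λ y → (1ℚ - ind (differ y z)) * f y) ≡ f z
differ-separated (suc n) f zero = begin
  ∑ (allFin (suc n)) (λ y → (1ℚ - ind (differ y zero)) * f y)
    ≡⟨ ∑-allFin-suc n (λ y → (1ℚ - ind (differ y zero)) * f y) ⟩
  (1ℚ - 0ℚ) * f zero + ∑ (allFin n) (λ y → (1ℚ - 1ℚ) * f (suc y))
    ≡⟨ cong₂ _+_ (ℚ.*-identityˡ (f zero))
         (∑-zero (allFin n) (λ y → ℚ.*-zeroˡ (f (suc y)))) ⟩
  f zero + 0ℚ
    ≡⟨ ℚ.+-identityʳ (f zero) ⟩
  f zero ∎
  where open ≡-Reasoning
differ-separated (suc n) f (suc z) = begin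
  ∑ (allFin (suc n)) (λ y → (1ℚ - ind (differ y (suc z))) * f y)
    ≡⟨ ∑-allFin-suc n (λ y → (1ℚ - ind (differ y (suc z))) * f y) ⟩
  (1ℚ - 1ℚ) * f zero + ∑ (allFin n) (λ y → (1ℚ - ind (differ y z)) * f (suc y))
    ≡⟨ cong₂ _+_ (ℚ.*-zeroˡ (f zero)) (differ-separated n (f ∘ suc) z) ⟩
  0ℚ + f (suc z)
    ≡⟨ ℚ.+-identityˡ (f (suc z)) ⟩
  f (suc z) ∎
  where open ≡-Reasoning

chromatic-polynomial : ∀ n {A : Set} (a : A → A → Bool) U →
  colouringCount a differ (allFin n) U ≡
  eval (fromTop (λ r → chromCoeff r a U) (length U)) (fromℕ n)
chromatic-polynomial n a U = trans
  (colouringCount-polynomial differ (allFin n) (differ-separated n) (length U) a U refl)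
  (cong (eval (fromTop (λ r → chromCoeff r a U) (length U))) (∑-allFin-1 n))

-- The recursion singles out the first vertex, so symmetry is not visible in it. Up to the length of
-- the list, the coefficients are determined by the colouring counts for all `n`, which ignore the
-- order; past it both sides vanish.
chromCoeff-symmetric : ∀ {A : Set} (a : A → A → Bool) → (∀ u v → a u v ≡ a v u) →
                       ∀ r → Symmetric (chromCoeff r a)
chromCoeff-symmetric a a-sym r {U} {W} p with r ℕ.≤? length U
... | yes r≤|U| = fromTop-injective (λ r → chromCoeff r a U) (λ r → chromCoeff r a W) (length U)
  (λ n → begin
    eval (fromTop (λ r → chromCoeff r a U) (length U)) (fromℕ n)
      ≡⟨ chromatic-polynomial n a U ⟨
    colouringCount a differ (allFin n) U
      ≡⟨ ∑-colourings-↭ (allFin n) (λ q → cong ind (proper-↭ a a-sym differ differ-sym q)) p ⟩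
    colouringCount a differ (allFin n) W
      ≡⟨ chromatic-polynomial n a W ⟩
    eval (fromTop (λ r → chromCoeff r a W) (length W)) (fromℕ n)
      ≡⟨ cong (λ M → eval (fromTop (λ r → chromCoeff r a W) M) (fromℕ n)) (↭-length p) ⟨
    eval (fromTop (λ r → chromCoeff r a W) (length U)) (fromℕ n) ∎) r r≤|U|
  where open ≡-Reasoning
... | no r≰|U| = trans (chromCoeff-vanish r a U |U|<r)
  (sym (chromCoeff-vanish r a W (subst (ℕ._< r) (↭-length p) |U|<r)))
  where |U|<r = ℕ.≰⇒> r≰|U|

-- Polynomial sequences

infixl 6 _⊕_
infixl 7 _⊗_

_⊕_ : Poly → Poly → Poly
[]      ⊕ p       = p
(a ∷ p) ⊕ []      = a ∷ p
(a ∷ p) ⊕ (b ∷ r) = a + b ∷ p ⊕ r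

_⊗_ : Poly → Poly → Poly
[]      ⊗ r = []
(a ∷ p) ⊗ r = map (a *_) r ⊕ (0ℚ ∷ p ⊗ r)

eval-⊕ : ∀ p r x → eval (p ⊕ r) x ≡ eval p x + eval r x
eval-⊕ []      r       x = sym (ℚ.+-identityˡ (eval r x))
eval-⊕ (a ∷ p) []      x = sym (ℚ.+-identityʳ (eval (a ∷ p) x))
eval-⊕ (a ∷ p) (b ∷ r) x = trans (cong (λ v → a + b + x * v) (eval-⊕ p r x))
  (solve 5 (λ a b x u v → a :+ b :+ x :* (u :+ v) := (a :+ x :* u) :+ (b :+ x :* v)) refl
    a b x (eval p x) (eval r x))

eval-scale : ∀ a p x → eval (map (a *_) p) x ≡ a * eval p x
eval-scale a []      x = sym (ℚ.*-zeroʳ a)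
eval-scale a (b ∷ p) x = trans (cong (λ v → a * b + x * v) (eval-scale a p x))
  (solve 4 (λ a b x u → a :* b :+ x :* (a :* u) := a :* (b :+ x :* u)) refl a b x (eval p x))

eval-⊗ : ∀ p r x → eval (p ⊗ r) x ≡ eval p x * eval r x
eval-⊗ []      r x = sym (ℚ.*-zeroˡ (eval r x))
eval-⊗ (a ∷ p) r x = begin
  eval (map (a *_) r ⊕ (0ℚ ∷ p ⊗ r)) x
    ≡⟨ eval-⊕ (map (a *_) r) (0ℚ ∷ p ⊗ r) x ⟩
  eval (map (a *_) r) x + (0ℚ + x * eval (p ⊗ r) x)
    ≡⟨ cong₂ (λ u v → u + (0ℚ + x * v)) (eval-scale a r x) (eval-⊗ p r x) ⟩
  a * eval r x + (0ℚ + x * (eval p x * eval r x))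
    ≡⟨ solve 4 (λ a x u v → a :* v :+ (con 0ℚ :+ x :* (u :* v)) := (a :+ x :* u) :* v) refl
         a x (eval p x) (eval r x) ⟩
  (a + x * eval p x) * eval r x ∎
  where open ≡-Reasoning

IsPolynomial : (ℕ → ℚ) → Set
IsPolynomial f = ∃ λ (p : Poly) → ∀ q → f q ≡ eval p (fromℕ q)

IsPolynomial-cong : ∀ {f g} → (∀ q → f q ≡ g q) → IsPolynomial g → IsPolynomial f
IsPolynomial-cong eq (p , g≡p) = p , λ q → trans (eq q) (g≡p q)

IsPolynomial-const : ∀ c → IsPolynomial (λ _ → c)
IsPolynomial-const c = c ∷ [] , λ q →
  solve 2 (λ c x → c := c :+ x :* con 0ℚ) refl c (fromℕ q)

IsPolynomial-+ : ∀ {f g} → IsPolynomial f → IsPolynomial g → IsPolynomial (λ q → f q + g q)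
IsPolynomial-+ (p , f≡p) (r , g≡r) = p ⊕ r , λ q →
  trans (cong₂ _+_ (f≡p q) (g≡r q)) (sym (eval-⊕ p r (fromℕ q)))

IsPolynomial-* : ∀ {f g} → IsPolynomial f → IsPolynomial g → IsPolynomial (λ q → f q * g q)
IsPolynomial-* (p , f≡p) (r , g≡r) = p ⊗ r , λ q →
  trans (cong₂ _*_ (f≡p q) (g≡r q)) (sym (eval-⊗ p r (fromℕ q)))

IsPolynomial-∑ : {A : Set} (xs : List A) {f : ℕ → A → ℚ} →
  (∀ x → IsPolynomial (λ q → f q x)) → IsPolynomial (λ q → ∑ xs (f q))
IsPolynomial-∑ []       poly = IsPolynomial-const 0ℚ
IsPolynomial-∑ (x ∷ xs) poly = IsPolynomial-+ (poly x) (IsPolynomial-∑ xs poly)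

T-does : {P : Set} (P? : Dec P) → T (does P?) → P
T-does (yes p) _ = p

does-T : {P : Set} (P? : Dec P) → P → T (does P?)
does-T (yes _) p = tt
does-T (no ¬p) p = ¬p p

-- Homomorphism counts as sums over tuples of vertices

vertices : (G : Graph) → List (Fin (size G))
vertices G = allFin (size G)

adjacent : (G : Graph) → Fin (size G) → Fin (size G) → Bool
adjacent G u v = does (adj? G u v)

adjacent-sym : ∀ G u v → adjacent G u v ≡ adjacent G v u
adjacent-sym G u v = does-⇔ (mk⇔ (symm G) (symm G)) (adj? G u v) (adj? G v u)

∑-allFin-+ : ∀ m n (f : Fin (m ℕ.+ n) → ℚ) →
  ∑ (allFin (m ℕ.+ n)) f ≡ ∑ (allFin m) (f ∘ (_↑ˡ n)) + ∑ (allFin n) (f ∘ (m ↑ʳ_))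
∑-allFin-+ zero    n f = sym (ℚ.+-identityˡ _)
∑-allFin-+ (suc m) n f = begin
  ∑ (allFin (suc m ℕ.+ n)) f
    ≡⟨ ∑-allFin-suc (m ℕ.+ n) f ⟩
  f zero + ∑ (allFin (m ℕ.+ n)) (f ∘ suc)
    ≡⟨ cong (f zero +_) (∑-allFin-+ m n (f ∘ suc)) ⟩
  f zero + (∑ (allFin m) (f ∘ suc ∘ (_↑ˡ n)) + ∑ (allFin n) (f ∘ suc ∘ (m ↑ʳ_)))
    ≡⟨ ℚ.+-assoc (f zero) _ _ ⟨
  f zero + ∑ (allFin m) (f ∘ suc ∘ (_↑ˡ n)) + ∑ (allFin n) (f ∘ (suc m ↑ʳ_))
    ≡⟨ cong (_+ ∑ (allFin n) (f ∘ (suc m ↑ʳ_))) (∑-allFin-suc m (f ∘ (_↑ˡ n))) ⟨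
  ∑ (allFin (suc m)) (f ∘ (_↑ˡ n)) + ∑ (allFin n) (f ∘ (suc m ↑ʳ_)) ∎
  where open ≡-Reasoning

∑-combine : ∀ m n (f : Fin (m ℕ.* n) → ℚ) →
  ∑ (allFin (m ℕ.* n)) f ≡ ∑ (allFin m) (λ i → ∑ (allFin n) (λ j → f (combine i j)))
∑-combine zero    n f = refl
∑-combine (suc m) n f = begin
  ∑ (allFin (n ℕ.+ m ℕ.* n)) f
    ≡⟨ ∑-allFin-+ n (m ℕ.* n) f ⟩
  ∑ (allFin n) (f ∘ (_↑ˡ m ℕ.* n)) + ∑ (allFin (m ℕ.* n)) (f ∘ (n ↑ʳ_))
    ≡⟨ cong (∑ (allFin n) (f ∘ (_↑ˡ m ℕ.* n)) +_) (∑-combine m n (f ∘ (n ↑ʳ_))) ⟩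
  ∑ (allFin n) (λ j → f (combine {suc m} zero j)) +
  ∑ (allFin m) (λ i → ∑ (allFin n) (λ j → f (combine (suc i) j)))
    ≡⟨ ∑-allFin-suc m (λ i → ∑ (allFin n) (λ j → f (combine i j))) ⟨
  ∑ (allFin (suc m)) (λ i → ∑ (allFin n) (λ j → f (combine i j))) ∎
  where open ≡-Reasoning

vectors : {C : Set} → List C → (m : ℕ) → List (Vec C m)
vectors cs zero    = [] ∷ []
vectors cs (suc m) = concatMap (λ y → map (y ∷_) (vectors cs m)) cs

∑-vectors-suc : {C : Set} (cs : List C) (m : ℕ) (f : Vec C (suc m) → ℚ) →
  ∑ (vectors cs (suc m)) f ≡ ∑ cs (λ y → ∑ (vectors cs m) (f ∘ (y ∷_)))
∑-vectors-suc cs m f = trans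
  (∑-concatMap (λ y → map (y ∷_) (vectors cs m)) cs f)
  (∑-cong cs (λ y → ∑-map (y ∷_) (vectors cs m) f))

∑-finToFun : ∀ n m (f : Vec (Fin n) m → ℚ) →
  ∑ (allFin (n ℕ.^ m)) (λ c → f (Vec.tabulate (finToFun {n} {m} c))) ≡ ∑ (vectors (allFin n) m) f
∑-finToFun n zero    f = refl
∑-finToFun n (suc m) f = begin
  ∑ (allFin (n ℕ.* n ℕ.^ m)) (λ c → f (Vec.tabulate (finToFun {n} {suc m} c)))
    ≡⟨ ∑-combine n (n ℕ.^ m) _ ⟩
  ∑ (allFin n) (λ y → ∑ (allFin (n ℕ.^ m)) (λ c →
    f (Vec.tabulate (finToFun {n} {suc m} (combine y c)))))
    ≡⟨ ∑-cong (allFin n) (λ y → trans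
         (∑-cong (allFin (n ℕ.^ m)) (λ c → cong
           (λ (y , c) → f (y ∷ Vec.tabulate (finToFun {n} {m} c))) (Fin.remQuot-combine {n} y c)))
         (∑-finToFun n m (f ∘ (y ∷_)))) ⟩
  ∑ (allFin n) (λ y → ∑ (vectors (allFin n) m) (f ∘ (y ∷_)))
    ≡⟨ ∑-vectors-suc (allFin n) m f ⟨
  ∑ (vectors (allFin n) (suc m)) f ∎
  where open ≡-Reasoning

fromℕ-count : ∀ {n} {A : Set} {P : A → Set} (P? : Decidable P) (g : Fin n → A) →
  fromℕ (Vec.count P? (Vec.tabulate g)) ≡ ∑ (tabulate g) (λ x → ind (does (P? x)))
fromℕ-count {zero}  P? g = refl
fromℕ-count {suc n} P? g with does (P? (g zero))
... | true  = trans
  (fromℕ-suc (Vec.count P? (Vec.tabulate (g ∘ suc)))) (cong (1ℚ +_) (fromℕ-count P? (g ∘ suc)))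
... | false = trans (fromℕ-count P? (g ∘ suc)) (sym (ℚ.+-identityˡ _))

-- Maps become vectors, over which sums can be taken one coordinate at a time; `b` is any Boolean
-- test for being a homomorphism.
hom-vectors : ∀ F G (b : Vec (Fin (size G)) (size F) → Bool) →
  (∀ φ → T (b (Vec.tabulate φ)) → IsHom F G φ) → (∀ φ → IsHom F G φ → T (b (Vec.tabulate φ))) →
  fromℕ (hom F G) ≡ ∑ (vectors (vertices G) (size F)) (ind ∘ b)
hom-vectors F G b sound complete = begin
  fromℕ (hom F G)
    ≡⟨ fromℕ-count (λ c → isHom? F G (finToFun c)) id ⟩
  ∑ (allFin (size G ℕ.^ size F)) (λ c → ind (does (isHom? F G (finToFun c))))
    ≡⟨ ∑-cong (allFin (size G ℕ.^ size F)) (λ c → cong ind (does-⇔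
         (mk⇔ (complete (finToFun c)) (sound (finToFun c)))
         (isHom? F G (finToFun c)) (T? (b (Vec.tabulate (finToFun c)))))) ⟩
  ∑ (allFin (size G ℕ.^ size F)) (λ c → ind (b (Vec.tabulate (finToFun c))))
    ≡⟨ ∑-finToFun (size G) (size F) (ind ∘ b) ⟩
  ∑ (vectors (vertices G) (size F)) (ind ∘ b) ∎
  where open ≡-Reasoning

-- Linear combinations of homomorphism counts

data Pattern : ℕ → Set where
  edges : ∀ {s} → List (Fin s × Fin s) → Pattern s
  sum   : ∀ {s} → Pattern (suc s) → Pattern s

module _ (G : Graph) where

  holds : ∀ {s} → Vec (Fin (size G)) s → Fin s × Fin s → Bool
  holds x (i , j) = adjacent G (lookup x i) (lookup x j)

  -- Counts the homomorphisms from the graph of the pattern with the images of its `s` free places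
  -- prescribed by `x`. As for homomorphisms, bound vertices may coincide with each other and with
  -- those of `x`.
  ⟦_⟧ : ∀ {s} → Pattern s → Vec (Fin (size G)) s → ℚ
  ⟦ edges M ⟧ x = ind (all (holds x) M)
  ⟦ sum t ⟧   x = ∑ (vertices G) (λ v → ⟦ t ⟧ (v ∷ x))

addEdge : ∀ {s} → Fin s × Fin s → Pattern s → Pattern s
addEdge e       (edges M) = edges (e ∷ M)
addEdge (i , j) (sum t)   = sum (addEdge (suc i , suc j) t)

⟦addEdge⟧ : ∀ G {s} (e : Fin s × Fin s) (t : Pattern s) x →
            ⟦_⟧ G (addEdge e t) x ≡ ind (holds G x e) * ⟦_⟧ G t x
⟦addEdge⟧ G e       (edges M) x = ind-∧ (holds G x e) (all (holds G x) M)
⟦addEdge⟧ G e@(i , j) (sum t) x = trans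
  (∑-cong (vertices G) (λ v → ⟦addEdge⟧ G (suc i , suc j) t (v ∷ x)))
  (∑-* (vertices G) (ind (holds G x e)) (λ v → ⟦_⟧ G t (v ∷ x)))

rename : ∀ {s t} → (Fin s → Fin t) → Pattern s → Pattern t
rename ρ (edges M) = edges (map (λ (i , j) → ρ i , ρ j) M)
rename ρ (sum t)   = sum (rename (lift 1 ρ) t)

⟦rename⟧ : ∀ G {s s′} (ρ : Fin s → Fin s′) (t : Pattern s) x y →
  (∀ i → lookup y (ρ i) ≡ lookup x i) → ⟦_⟧ G (rename ρ t) y ≡ ⟦_⟧ G t x
⟦rename⟧ G ρ (edges M) x y eq = cong ind (trans (all-map (holds G y) _ M)
  (all-cong M (λ (i , j) → cong₂ (adjacent G) (eq i) (eq j))))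
⟦rename⟧ G ρ (sum t)   x y eq = ∑-cong (vertices G) (λ v →
  ⟦rename⟧ G (lift 1 ρ) t (v ∷ x) (v ∷ y) (λ { zero → refl ; (suc i) → eq i }))

Parameter : ℕ → Set₁
Parameter s = (G : Graph) → Vec (Fin (size G)) s → ℚ

-- The `terms` are chosen before `G`. One combination serves all graphs, and this uniformity is what
-- carries polynomiality in `q` over to the parameter.
record Definable {s : ℕ} (φ : Parameter s) : Set₁ where
  field
    terms   : List (ℚ × Pattern s)
    correct : ∀ G x → φ G x ≡ ∑ terms (λ (c , t) → c * ⟦_⟧ G t x)

open Definable

module _ {s : ℕ} where

  Definable-cong : {φ ψ : Parameter s} → (∀ G x → φ G x ≡ ψ G x) → Definable ψ → Definable φ
  Definable-cong eq dψ .terms       = dψ .terms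
  Definable-cong eq dψ .correct G x = trans (eq G x) (dψ .correct G x)

  Definable-const : ∀ c → Definable {s} (λ _ _ → c)
  Definable-const c .terms       = (c , edges []) ∷ []
  Definable-const c .correct G x = solve 1 (λ c → c := c :* con 1ℚ :+ con 0ℚ) refl c

  Definable-+ : {φ ψ : Parameter s} →
    Definable φ → Definable ψ → Definable (λ G x → φ G x + ψ G x)
  Definable-+ dφ dψ .terms       = dφ .terms ++ dψ .terms
  Definable-+ dφ dψ .correct G x = trans (cong₂ _+_ (dφ .correct G x) (dψ .correct G x))
    (sym (∑-++ (dφ .terms) (dψ .terms) _))

  Definable-* : {φ : Parameter s} (k : ℚ) → Definable φ → Definable (λ G x → k * φ G x)
  Definable-* k dφ .terms       = map (λ (c , t) → k * c , t) (dφ .terms)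
  Definable-* {φ} k dφ .correct G x = begin
    k * φ G x
      ≡⟨ cong (k *_) (dφ .correct G x) ⟩
    k * ∑ (dφ .terms) (λ (c , t) → c * ⟦_⟧ G t x)
      ≡⟨ ∑-* (dφ .terms) k _ ⟨
    ∑ (dφ .terms) (λ (c , t) → k * (c * ⟦_⟧ G t x))
      ≡⟨ ∑-cong (dφ .terms) (λ (c , t) → ℚ.*-assoc k c (⟦_⟧ G t x)) ⟨
    ∑ (dφ .terms) (λ (c , t) → k * c * ⟦_⟧ G t x)
      ≡⟨ ∑-map (λ (c , t) → k * c , t) (dφ .terms) _ ⟨
    ∑ (map (λ (c , t) → k * c , t) (dφ .terms)) (λ (c , t) → c * ⟦_⟧ G t x) ∎
    where open ≡-Reasoning

  Definable-- : {φ ψ : Parameter s} →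
    Definable φ → Definable ψ → Definable (λ G x → φ G x - ψ G x)
  Definable-- {φ} {ψ} dφ dψ = Definable-cong
    (λ G x → solve 2 (λ a b → a :- b := a :+ con (- 1ℚ) :* b) refl (φ G x) (ψ G x))
    (Definable-+ dφ (Definable-* (- 1ℚ) dψ))

  Definable-∑ : {A : Set} (xs : List A) {φ : A → Parameter s} →
    (∀ a → Definable (φ a)) → Definable (λ G x → ∑ xs (λ a → φ a G x))
  Definable-∑ []       dφ = Definable-const 0ℚ
  Definable-∑ (a ∷ xs) dφ = Definable-+ (dφ a) (Definable-∑ xs dφ)

  Definable-edge : {φ : Parameter s} (e : Fin s × Fin s) →
    Definable φ → Definable (λ G x → ind (holds G x e) * φ G x)
  Definable-edge e dφ .terms = map (λ (c , t) → c , addEdge e t) (dφ .terms)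
  Definable-edge {φ} e dφ .correct G x = begin
    ε * φ G x
      ≡⟨ cong (ε *_) (dφ .correct G x) ⟩
    ε * ∑ (dφ .terms) (λ (c , t) → c * ⟦_⟧ G t x)
      ≡⟨ ∑-* (dφ .terms) ε _ ⟨
    ∑ (dφ .terms) (λ (c , t) → ε * (c * ⟦_⟧ G t x))
      ≡⟨ ∑-cong (dφ .terms) (λ (c , t) → trans
           (solve 3 (λ e c t → e :* (c :* t) := c :* (e :* t)) refl ε c (⟦_⟧ G t x))
           (cong (c *_) (sym (⟦addEdge⟧ G e t x)))) ⟩
    ∑ (dφ .terms) (λ (c , t) → c * ⟦_⟧ G (addEdge e t) x)
      ≡⟨ ∑-map (λ (c , t) → c , addEdge e t) (dφ .terms) _ ⟨
    ∑ (map (λ (c , t) → c , addEdge e t) (dφ .terms)) (λ (c , t) → c * ⟦_⟧ G t x) ∎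
    where
    open ≡-Reasoning
    ε : ℚ
    ε = ind (holds G x e)

  Definable-sum : {φ : Parameter (suc s)} → Definable φ →
    Definable (λ G x → ∑ (vertices G) (λ v → φ G (v ∷ x)))
  Definable-sum dφ .terms = map (λ (c , t) → c , sum t) (dφ .terms)
  Definable-sum {φ} dφ .correct G x = begin
    ∑ (vertices G) (λ v → φ G (v ∷ x))
      ≡⟨ ∑-cong (vertices G) (λ v → dφ .correct G (v ∷ x)) ⟩
    ∑ (vertices G) (λ v → ∑ (dφ .terms) (λ (c , t) → c * ⟦_⟧ G t (v ∷ x)))
      ≡⟨ ∑-swap (vertices G) (dφ .terms) _ ⟩
    ∑ (dφ .terms) (λ (c , t) → ∑ (vertices G) (λ v → c * ⟦_⟧ G t (v ∷ x)))
      ≡⟨ ∑-cong (dφ .terms) (λ (c , t) → ∑-* (vertices G) c _) ⟩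
    ∑ (dφ .terms) (λ (c , t) → c * ⟦_⟧ G (sum t) x)
      ≡⟨ ∑-map (λ (c , t) → c , sum t) (dφ .terms) _ ⟨
    ∑ (map (λ (c , t) → c , sum t) (dφ .terms)) (λ (c , t) → c * ⟦_⟧ G t x) ∎
    where open ≡-Reasoning

  -- Setting the newest vertex equal to an earlier one identifies two places of each pattern; the
  -- subtracted terms of `∑-fresh` are of this kind.
  Definable-repeat : {φ : Parameter (suc s)} (i : Fin s) → Definable φ →
    Definable (λ G x → φ G (lookup x i ∷ x))
  Definable-repeat i dφ .terms = map (λ (c , t) → c , rename ρ t) (dφ .terms)
    where
    ρ : Fin (suc s) → Fin s
    ρ zero    = i
    ρ (suc j) = j
  Definable-repeat {φ} i dφ .correct G x = trans (dφ .correct G (lookup x i ∷ x)) (trans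
    (∑-cong (dφ .terms) (λ (c , t) → cong (c *_) (sym
      (⟦rename⟧ G _ t (lookup x i ∷ x) x (λ { zero → refl ; (suc j) → refl })))))
    (sym (∑-map _ (dφ .terms) _)))

  -- Every function of finitely many bits is a multilinear polynomial in them, by splitting on one
  -- bit at a time as in `choose`; multiplying by an adjacency bit adds an edge.
  Definable-Bool : ∀ {k} (es : Vec (Fin s × Fin s) k) (f : Vec Bool k → ℚ) →
    Definable (λ G x → f (Vec.map (holds G x) es))
  Definable-Bool []       f = Definable-const (f [])
  Definable-Bool (e ∷ es) f = Definable-cong (λ G x → choose (holds G x e) (Vec.map (holds G x) es))
    (Definable-+ (Definable-Bool es (f ∘ (false ∷_)))
      (Definable-edge e (Definable-- (Definable-Bool es (f ∘ (true ∷_)))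
                                     (Definable-Bool es (f ∘ (false ∷_))))))
    where
    choose : ∀ b bs → f (b ∷ bs) ≡ f (false ∷ bs) + ind b * (f (true ∷ bs) - f (false ∷ bs))
    choose true  bs = solve 2 (λ a b → a := b :+ con 1ℚ :* (a :- b)) refl
      (f (true ∷ bs)) (f (false ∷ bs))
    choose false bs = solve 2 (λ a b → b := b :+ con 0ℚ :* (a :- b)) refl
      (f (true ∷ bs)) (f (false ∷ bs))

toList-lookup : ∀ {C : Set} {s} (x : Vec C s) → toList x ≡ map (lookup x) (allFin s)
toList-lookup x = trans (eq x) (sym (map-tabulate id (lookup x)))
  where
  eq : ∀ {C : Set} {s} (x : Vec C s) → toList x ≡ tabulate (lookup x)
  eq []      = refl
  eq (v ∷ x) = cong (v ∷_) (eq x)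

-- Inequality of vertices is not an edge condition, but the subtractive form of `∑-fresh` involves
-- only free sums and repetitions. Unfolding it is the inclusion-exclusion.
Definable-fresh : ∀ m (f : (G : Graph) → List (Fin (size G)) → ℚ) →
  (∀ s → Definable {s} (λ G x → f G (toList x))) →
  ∀ s → Definable {s} (λ G x → ∑-fresh (vertices G) m (f G) (toList x))
Definable-fresh zero    f df s = df s
Definable-fresh (suc m) f df s = Definable-cong
  (λ G x → cong (λ y → ∑ (vertices G) (λ v → ∑-fresh (vertices G) m (f G) (v ∷ toList x)) - y)
    (trans (cong (λ us → ∑ us (λ u → ∑-fresh (vertices G) m (f G) (u ∷ toList x)))
                 (toList-lookup x))
           (∑-map (lookup x) (allFin s) _)))
  (Definable-- (Definable-sum (Definable-fresh m f df (suc s)))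
    (Definable-∑ (allFin s) (λ i → Definable-repeat i (Definable-fresh m f df (suc s)))))

-- Relabelling vertices by their positions in the tuple makes the value a function of the `s` by `s`
-- table of adjacencies alone.
Definable-mobius : ∀ r s →
  Definable {s} (λ G x → mobius (chromCoeff r (adjacent G)) (toList x))
Definable-mobius r s = Definable-cong
  (λ G x → begin
    mobius (chromCoeff r (adjacent G)) (toList x)
      ≡⟨ cong (mobius (chromCoeff r (adjacent G))) (toList-lookup x) ⟩
    mobius (chromCoeff r (adjacent G)) (map (lookup x) (allFin s))
      ≡⟨ mobius-map (chromCoeff r (adjacent G)) (lookup x) (allFin s) ⟩
    mobius (chromCoeff r (adjacent G) ∘ map (lookup x)) (allFin s)
      ≡⟨ mobius-cong (allFin s) (chromCoeff-map r (lookup x) (entry G x)) ⟩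
    f (Vec.map (holds G x) pairs) ∎)
  (Definable-Bool pairs f)
  where
  open ≡-Reasoning
  pairs : Vec (Fin s × Fin s) (s ℕ.* s)
  pairs = Vec.tabulate (remQuot s)
  f : Vec Bool (s ℕ.* s) → ℚ
  f bs = mobius (chromCoeff r (λ i j → lookup bs (combine i j))) (allFin s)
  entry : ∀ G x i j → adjacent G (lookup x i) (lookup x j) ≡
                      lookup (Vec.map (holds G x) pairs) (combine i j)
  entry G x i j = sym (begin
    lookup (Vec.map (holds G x) pairs) (combine i j)
      ≡⟨ Vec.lookup-map (combine i j) (holds G x) pairs ⟩
    holds G x (lookup pairs (combine i j))
      ≡⟨ cong (holds G x) (Vec.lookup∘tabulate (remQuot s) (combine i j)) ⟩
    holds G x (remQuot s (combine i j))
      ≡⟨ cong (holds G x) (Fin.remQuot-combine i j) ⟩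
    holds G x (i , j) ∎)

!-inverse : ∀ m → ∃ λ k → k * fromℕ (m !) ≡ 1ℚ
!-inverse m = 1/ fromℕ (m !) , ℚ.*-inverseˡ (fromℕ (m !))
  where
  instance
    m!-nonZero : ℚ.NonZero (fromℕ (m !))
    m!-nonZero = ℚ.≢-nonZero (λ eq → ℕ.≢-nonZero⁻¹ (m !) {{m ℕ.!≢0}} (fromℕ-injective {m !} {0} eq))

Definable-∑< : ∀ {s} D {φ : ℕ → Parameter s} →
  (∀ m → Definable (φ m)) → Definable (λ G x → ∑< D (λ m → φ m G x))
Definable-∑< zero    dφ = Definable-const 0ℚ
Definable-∑< (suc D) dφ = Definable-+ (dφ 0) (Definable-∑< D (dφ ∘ suc))

Definable-chromCoeff : ∀ r → Definable {0} (λ G _ → chromCoeff r (adjacent G) (vertices G))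
Definable-chromCoeff r = Definable-cong
  (λ { G [] → trans
    (sym (mobius-inversion D {chromCoeff r (adjacent G)} (Degree<-chromCoeff r (adjacent G)) (vertices G)))
    (∑<-cong D (sublists-fresh G)) })
  (Definable-∑< D (λ m → Definable-* (proj₁ (!-inverse m))
    (Definable-fresh m (λ G → mobius (chromCoeff r (adjacent G))) (Definable-mobius r) 0)))
  where
  open ≡-Reasoning
  D : ℕ
  D = suc (r ℕ.* 2)
  sublists-fresh : ∀ G m → ∑ (sublists m (vertices G)) (mobius (chromCoeff r (adjacent G))) ≡
    proj₁ (!-inverse m) * ∑-fresh (vertices G) m (mobius (chromCoeff r (adjacent G))) []
  sublists-fresh G m = begin
    ∑ (sublists m V) f
      ≡⟨ ℚ.*-identityˡ _ ⟨
    1ℚ * ∑ (sublists m V) f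
      ≡⟨ cong (_* ∑ (sublists m V) f) (proj₂ (!-inverse m)) ⟨
    k * fromℕ (m !) * ∑ (sublists m V) f
      ≡⟨ ℚ.*-assoc k (fromℕ (m !)) _ ⟩
    k * (fromℕ (m !) * ∑ (sublists m V) f)
      ≡⟨ cong (k *_) (∑-arrangements-sublists m f-sym V) ⟨
    k * ∑ (arrangements m V) f
      -- `∑-fresh` accumulates its choices in reverse, which symmetry absorbs.
      ≡⟨ cong (k *_) (∑-cong (arrangements m V) (λ ws → f-sym (↭-reverse ws))) ⟨
    k * ∑ (arrangements m V) (λ ws → f (ws ʳ++ []))
      ≡⟨ cong (k *_) (∑-arrangements-fresh V m f V [] (↭-reflexive (++-identityʳ V))) ⟩
    k * ∑-fresh V m f [] ∎
    where
    k : ℚ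
    k = proj₁ (!-inverse m)
    V : List (Fin (size G))
    V = vertices G
    f : List (Fin (size G)) → ℚ
    f = mobius (chromCoeff r (adjacent G))
    f-sym : Symmetric f
    f-sym = mobius-symmetric (chromCoeff-symmetric (adjacent G) (adjacent-sym G) r)

-- From patterns to polynomials in q

module _ {s : ℕ} (M : List (Fin s × Fin s)) where

  open DecMembership (Product.≡-dec (Fin._≟_ {s}) (Fin._≟_ {s})) using (_∈?_)

  -- The pairs of `M` may be given in one direction only or be loops. Symmetrising and removing the
  -- diagonal yields a simple graph, with the intended homomorphisms when `M` has no loop.
  edgeGraph : Graph
  edgeGraph = record
    { size   = s
    ; Adj    = λ i j → i ≢ j × ((i , j) ∈ M ⊎ (j , i) ∈ M)
    ; adj?   = λ i j → ¬? (i Fin.≟ j) ×-dec ((i , j) ∈? M ⊎-dec (j , i) ∈? M)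
    ; symm   = λ (i≢j , ij∈M) → (i≢j ∘ sym) , Sum.swap ij∈M
    ; irrefl = λ i≡j (i≢j , _) → i≢j i≡j
    }

  hom-edgeGraph : All (λ (i , j) → i ≢ j) M → ∀ G →
    fromℕ (hom edgeGraph G) ≡ ∑ (vectors (vertices G) s) (⟦_⟧ G (edges M))
  hom-edgeGraph loopless G = hom-vectors edgeGraph G (λ x → all (holds G x) M) sound complete
    where
    sound : ∀ φ → T (all (holds G (Vec.tabulate φ)) M) → IsHom edgeGraph G φ
    sound φ t i j (_ , ij∈M) = Sum.[ adj , symm G ∘ adj ] ij∈M
      where
      adj : ∀ {i j} → (i , j) ∈ M → Adj G (φ i) (φ j)
      adj {i} {j} e = subst₂ (Adj G) (Vec.lookup∘tabulate φ i) (Vec.lookup∘tabulate φ j)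
        (T-does (adj? G _ _) (All.lookup (All.all⁺ (holds G (Vec.tabulate φ)) M t) e))
    complete : ∀ φ → IsHom edgeGraph G φ → T (all (holds G (Vec.tabulate φ)) M)
    complete φ φ-hom = All.all⁻ (holds G (Vec.tabulate φ)) (All.tabulate λ { {i , j} e →
      does-T (adj? G _ _) (subst₂ (Adj G)
        (sym (Vec.lookup∘tabulate φ i)) (sym (Vec.lookup∘tabulate φ j))
        (φ-hom i j (All.lookup loopless e , inj₁ e))) })

  edges-loop : ¬ All (λ (i , j) → i ≢ j) M → ∀ G x → ⟦_⟧ G (edges M) x ≡ 0ℚ
  edges-loop loop G x with all (holds G x) M in eq
  ... | false = refl
  ... | true  = contradiction
    (All.map (λ {(i , j)} t i≡j → irrefl G (cong (lookup x) i≡j) (T-does (adj? G _ _) t))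
      (All.all⁺ (holds G x) M (subst T (sym eq) _)))
    loop

module _ (G : ℕ → Graph) (G-poly : StronglyPolynomial G) where

  -- Summing over the free places as well makes the induction go through: a bound vertex becomes one
  -- more free place, until only edges remain.
  IsPolynomial-pattern : ∀ {s} (t : Pattern s) →
    IsPolynomial (λ q → ∑ (vectors (vertices (G q)) s) (⟦_⟧ (G q) t))
  IsPolynomial-pattern (edges M) with All.all? (λ (i , j) → ¬? (i Fin.≟ j)) M
  ... | yes loopless = IsPolynomial-cong (λ q → sym (hom-edgeGraph M loopless (G q)))
                                         (G-poly (edgeGraph M))
  ... | no  loop     = IsPolynomial-cong
    (λ q → ∑-zero (vectors (vertices (G q)) _) (edges-loop M loop (G q))) (IsPolynomial-const 0ℚ)
  IsPolynomial-pattern {s} (sum t) = IsPolynomial-cong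
    (λ q → trans (∑-swap (vectors (vertices (G q)) s) (vertices (G q)) _)
                 (sym (∑-vectors-suc (vertices (G q)) s (⟦_⟧ (G q) t))))
    (IsPolynomial-pattern t)

  IsPolynomial-definable : ∀ {φ : Parameter 0} → Definable φ → IsPolynomial (λ q → φ (G q) [])
  IsPolynomial-definable dφ = IsPolynomial-cong (λ q → dφ .correct (G q) [])
    (IsPolynomial-∑ (dφ .terms) (λ (c , t) → IsPolynomial-* (IsPolynomial-const c)
      (IsPolynomial-cong (λ q → sym (ℚ.+-identityʳ (⟦_⟧ (G q) t []))) (IsPolynomial-pattern t))))

  IsPolynomial-chromCoeff : ∀ r →
    IsPolynomial (λ q → chromCoeff r (adjacent (G q)) (vertices (G q)))
  IsPolynomial-chromCoeff r = IsPolynomial-definable (Definable-chromCoeff r)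

-- Categorical powers of complete graphs

∑-colourings-tabulate : ∀ {A C : Set} (cs : List C) {m} (g : Fin m → A) (f : List (A × C) → ℚ) →
  ∑ (colourings cs (tabulate g)) f ≡ ∑ (vectors cs m) (λ x → f (tabulate (λ i → g i , lookup x i)))
∑-colourings-tabulate cs {zero}  g f = refl
∑-colourings-tabulate cs {suc m} g f = begin
  ∑ (colourings cs (tabulate g)) f
    ≡⟨ ∑-colourings-∷ cs (g zero) (tabulate (g ∘ suc)) f ⟩
  ∑ cs (λ y → ∑ (colourings cs (tabulate (g ∘ suc))) (f ∘ ((g zero , y) ∷_)))
    ≡⟨ ∑-cong cs (λ y → ∑-colourings-tabulate cs (g ∘ suc) (f ∘ ((g zero , y) ∷_))) ⟩
  ∑ cs (λ y → ∑ (vectors cs m) (λ x → f ((g zero , y) ∷ tabulate (λ i → g (suc i) , lookup x i))))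
    ≡⟨ ∑-vectors-suc cs m _ ⟨
  ∑ (vectors cs (suc m)) (λ x → f (tabulate (λ i → g i , lookup x i))) ∎
  where open ≡-Reasoning

module _ {A C : Set} (a : A → A → Bool) (ne : C → C → Bool) where

  proper-tabulate⁺ : ∀ {m} (h : Fin m → A × C) →
    (∀ i j → T (compatible a ne (h i) (h j))) → T (proper a ne (tabulate h))
  proper-tabulate⁺ {zero}  h comp = _
  proper-tabulate⁺ {suc m} h comp = Equivalence.from T-∧
    ( All.all⁻ (compatible a ne (h zero)) (All.tabulate⁺ (λ j → comp zero (suc j)))
    , proper-tabulate⁺ (h ∘ suc) (λ i j → comp (suc i) (suc j)))

  -- Pairs against the list order follow by symmetry. The diagonal is never tested, and in
  -- `hom-colouringCount` an edge from a vertex to itself is excluded by `irrefl`.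
  proper-tabulate⁻ : (∀ u v → a u v ≡ a v u) → (∀ y z → ne y z ≡ ne z y) →
    ∀ {m} (h : Fin m → A × C) → T (proper a ne (tabulate h)) →
    ∀ i j → i ≢ j → T (compatible a ne (h i) (h j))
  proper-tabulate⁻ a-sym ne-sym {suc m} h t = go
    where
    split = Equivalence.to (T-∧ {all (compatible a ne (h zero)) (tabulate (h ∘ suc))}) t
    later : ∀ j → T (compatible a ne (h zero) (h (suc j)))
    later = All.tabulate⁻ (All.all⁺ (compatible a ne (h zero)) (tabulate (h ∘ suc)) (proj₁ split))
    go : ∀ i j → i ≢ j → T (compatible a ne (h i) (h j))
    go zero    zero    i≢j = contradiction refl i≢j
    go zero    (suc j) i≢j = later j
    go (suc i) zero    i≢j = subst T
      (cong₂ (λ b c → not b ∨ c) (a-sym _ _) (ne-sym _ _)) (later i)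
    go (suc i) (suc j) i≢j =
      proper-tabulate⁻ a-sym ne-sym (h ∘ suc) (proj₂ split) i j (i≢j ∘ cong suc)

hom-colouringCount : ∀ G H →
  fromℕ (hom G H) ≡ colouringCount (adjacent G) (adjacent H) (vertices H) (vertices G)
hom-colouringCount G H = trans
  (hom-vectors G H (λ x → proper a ne (tabulate (λ i → i , lookup x i))) sound complete)
  (sym (∑-colourings-tabulate (vertices H) id (ind ∘ proper a ne)))
  where
  a  = adjacent G
  ne = adjacent H
  sound : ∀ φ → T (proper a ne (tabulate (λ i → i , lookup (Vec.tabulate φ) i))) → IsHom G H φ
  sound φ t u v u~v = subst₂ (Adj H) (Vec.lookup∘tabulate φ u) (Vec.lookup∘tabulate φ v)
    (T-does (adj? H _ _) (subst (λ b → T (not b ∨ ne _ _)) (dec-true (adj? G u v) u~v)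
      (proper-tabulate⁻ a ne (adjacent-sym G) (adjacent-sym H) _ t u v
        (λ u≡v → irrefl G u≡v u~v))))
  complete : ∀ φ → IsHom G H φ → T (proper a ne (tabulate (λ i → i , lookup (Vec.tabulate φ) i)))
  complete φ φ-hom = proper-tabulate⁺ a ne _ comp
    where
    comp : ∀ u v → T (compatible a ne (u , lookup (Vec.tabulate φ) u) (v , lookup (Vec.tabulate φ) v))
    comp u v with adj? G u v
    ... | no  _   = _
    ... | yes u~v = does-T (adj? H _ _) (subst₂ (Adj H)
      (sym (Vec.lookup∘tabulate φ u)) (sym (Vec.lookup∘tabulate φ v)) (φ-hom u v u~v))

module _ {C C₁ C₂ : Set} (π₁ : C → C₁) (π₂ : C → C₂)
         (cs : List C) (cs₁ : List C₁) (cs₂ : List C₂)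
         (∑-product : ∀ f₁ f₂ → ∑ cs (λ c → f₁ (π₁ c) * f₂ (π₂ c)) ≡ ∑ cs₁ f₁ * ∑ cs₂ f₂) where

  ∑-colourings-product : ∀ {A : Set} (U : List A)
    (f₁ : List (A × C₁) → ℚ) (f₂ : List (A × C₂) → ℚ) →
    ∑ (colourings cs U) (λ ps → f₁ (map (map₂ π₁) ps) * f₂ (map (map₂ π₂) ps)) ≡
    ∑ (colourings cs₁ U) f₁ * ∑ (colourings cs₂ U) f₂
  ∑-colourings-product []      f₁ f₂ =
    solve 2 (λ a b → a :* b :+ con 0ℚ := (a :+ con 0ℚ) :* (b :+ con 0ℚ)) refl (f₁ []) (f₂ [])
  ∑-colourings-product (v ∷ U) f₁ f₂ = begin
    ∑ (colourings cs (v ∷ U)) (λ ps → f₁ (map (map₂ π₁) ps) * f₂ (map (map₂ π₂) ps))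
      ≡⟨ ∑-colourings-∷ cs v U _ ⟩
    ∑ cs (λ c → ∑ (colourings cs U) (λ ps →
      f₁ ((v , π₁ c) ∷ map (map₂ π₁) ps) * f₂ ((v , π₂ c) ∷ map (map₂ π₂) ps)))
      ≡⟨ ∑-cong cs (λ c → ∑-colourings-product U (f₁ ∘ ((v , π₁ c) ∷_)) (f₂ ∘ ((v , π₂ c) ∷_))) ⟩
    ∑ cs (λ c → ∑ (colourings cs₁ U) (f₁ ∘ ((v , π₁ c) ∷_)) *
                ∑ (colourings cs₂ U) (f₂ ∘ ((v , π₂ c) ∷_)))
      ≡⟨ ∑-product (λ y → ∑ (colourings cs₁ U) (f₁ ∘ ((v , y) ∷_)))
                   (λ z → ∑ (colourings cs₂ U) (f₂ ∘ ((v , z) ∷_))) ⟩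
    ∑ cs₁ (λ y → ∑ (colourings cs₁ U) (f₁ ∘ ((v , y) ∷_))) *
    ∑ cs₂ (λ z → ∑ (colourings cs₂ U) (f₂ ∘ ((v , z) ∷_)))
      ≡⟨ cong₂ _*_ (∑-colourings-∷ cs₁ v U f₁) (∑-colourings-∷ cs₂ v U f₂) ⟨
    ∑ (colourings cs₁ (v ∷ U)) f₁ * ∑ (colourings cs₂ (v ∷ U)) f₂ ∎
    where open ≡-Reasoning

  -- A colouring by pairs is a pair of colourings, and for a conjunction of colour relations the
  -- indicator of properness factors accordingly.
  colouringCount-product : ∀ {A : Set} (a : A → A → Bool)
    (ne : C → C → Bool) (ne₁ : C₁ → C₁ → Bool) (ne₂ : C₂ → C₂ → Bool) →
    (∀ c d → ne c d ≡ ne₁ (π₁ c) (π₁ d) ∧ ne₂ (π₂ c) (π₂ d)) → ∀ U →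
    colouringCount a ne cs U ≡ colouringCount a ne₁ cs₁ U * colouringCount a ne₂ cs₂ U
  colouringCount-product {A} a ne ne₁ ne₂ eq U = trans
    (∑-cong (colourings cs U) (λ ps → trans (cong ind (proper-product ps))
      (ind-∧ (proper a ne₁ (map (map₂ π₁) ps)) _)))
    (∑-colourings-product U (ind ∘ proper a ne₁) (ind ∘ proper a ne₂))
    where
    open ≡-Reasoning
    compatible-product : ∀ x y → compatible a ne x y ≡
      compatible a ne₁ (map₂ π₁ x) (map₂ π₁ y) ∧ compatible a ne₂ (map₂ π₂ x) (map₂ π₂ y)
    compatible-product (u , c) (v , d) = trans (cong (not (a u v) ∨_) (eq c d)) (distrib (a u v))
      where
      distrib : ∀ b {e f} → not b ∨ (e ∧ f) ≡ (not b ∨ e) ∧ (not b ∨ f)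
      distrib true  = refl
      distrib false = refl
    proper-product : ∀ ps → proper a ne ps ≡
      proper a ne₁ (map (map₂ π₁) ps) ∧ proper a ne₂ (map (map₂ π₂) ps)
    proper-product []       = refl
    proper-product (x ∷ ps) = begin
      all (compatible a ne x) ps ∧ proper a ne ps
        ≡⟨ cong₂ _∧_ (trans (all-cong ps (compatible-product x)) (trans (all-∧ _ _ ps)
             (cong₂ _∧_ (sym (all-map _ _ ps)) (sym (all-map _ _ ps)))))
             (proper-product ps) ⟩
      (all₁ ∧ all₂) ∧ (proper₁ ∧ proper₂)
        ≡⟨ interchange all₁ all₂ proper₁ proper₂ ⟩
      (all₁ ∧ proper₁) ∧ (all₂ ∧ proper₂) ∎
      where
      all₁ = all (compatible a ne₁ (map₂ π₁ x)) (map (map₂ π₁) ps)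
      all₂ = all (compatible a ne₂ (map₂ π₂ x)) (map (map₂ π₂) ps)
      proper₁ = proper a ne₁ (map (map₂ π₁) ps)
      proper₂ = proper a ne₂ (map (map₂ π₂) ps)

infixr 8 _^ℚ_

_^ℚ_ : ℚ → ℕ → ℚ
x ^ℚ zero    = 1ℚ
x ^ℚ (suc k) = x * x ^ℚ k

differEverywhere : ∀ {n} k → Fin (n ℕ.^ k) → Fin (n ℕ.^ k) → Bool
differEverywhere k u v = does (Fin.all? {n = k} (λ i → ¬? (finToFun u i Fin.≟ finToFun v i)))

-- Boolean colour relations let the induction start at `k = 0`, where the single colour is
-- compatible with itself and so corresponds to no simple graph.
colouringCount-power : ∀ n k {A : Set} (a : A → A → Bool) U →
  colouringCount a (differEverywhere {n} k) (allFin (n ℕ.^ k)) U ≡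
  colouringCount a differ (allFin n) U ^ℚ k
colouringCount-power n zero    {A} a U = trans
  (∑-cong (colourings (allFin 1) U) (λ ps → cong ind (always-proper ps))) (single U)
  where
  always-proper : ∀ ps → proper a (differEverywhere {n} 0) ps ≡ true
  always-proper []             = refl
  always-proper ((u , c) ∷ ps) = cong₂ _∧_ (always-compatible ps) (always-proper ps)
    where
    always-compatible : ∀ ps → all (compatible a (differEverywhere {n} 0) (u , c)) ps ≡ true
    always-compatible []             = refl
    always-compatible ((v , d) ∷ ps) = cong₂ _∧_ (∨-zeroʳ (not (a u v))) (always-compatible ps)
  single : ∀ (U : List A) → ∑ (colourings (allFin 1) U) (λ _ → 1ℚ) ≡ 1ℚ
  single []      = refl
  single (v ∷ U) = trans (∑-colourings-∷ (allFin 1) v U (λ _ → 1ℚ)) (cong (_+ 0ℚ) (single U))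
colouringCount-power n (suc k) a U = trans
  -- A tuple code splits into its first coordinate and the code of the rest; on these
  -- `differEverywhere` computes to the required conjunction, whence `refl`.
  (colouringCount-product (quotient {n} (n ℕ.^ k)) (remainder {n} (n ℕ.^ k))
    (allFin (n ℕ.^ suc k)) (allFin n) (allFin (n ℕ.^ k)) ∑-product
    a (differEverywhere {n} (suc k)) differ (differEverywhere {n} k) (λ c d → refl) U)
  (cong (colouringCount a differ (allFin n) U *_) (colouringCount-power n k a U))
  where
  open ≡-Reasoning
  ∑-product : ∀ f₁ f₂ →
    ∑ (allFin (n ℕ.* n ℕ.^ k)) (λ c → f₁ (quotient {n} (n ℕ.^ k) c) * f₂ (remainder {n} (n ℕ.^ k) c)) ≡
    ∑ (allFin n) f₁ * ∑ (allFin (n ℕ.^ k)) f₂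
  ∑-product f₁ f₂ = begin
    ∑ (allFin (n ℕ.* n ℕ.^ k)) (λ c → f₁ (quotient {n} (n ℕ.^ k) c) * f₂ (remainder {n} (n ℕ.^ k) c))
      ≡⟨ ∑-combine n (n ℕ.^ k) _ ⟩
    ∑ (allFin n) (λ y → ∑ (allFin (n ℕ.^ k)) (λ z →
      f₁ (quotient {n} (n ℕ.^ k) (combine y z)) * f₂ (remainder {n} (n ℕ.^ k) (combine y z))))
      ≡⟨ ∑-cong (allFin n) (λ y → trans
           (∑-cong (allFin (n ℕ.^ k)) (λ z →
             cong (λ (y , z) → f₁ y * f₂ z) (Fin.remQuot-combine {n} y z)))
           (trans (∑-* (allFin (n ℕ.^ k)) (f₁ y) f₂) (ℚ.*-comm (f₁ y) s₂))) ⟩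
    ∑ (allFin n) (λ y → s₂ * f₁ y)
      ≡⟨ trans (∑-* (allFin n) s₂ f₁) (ℚ.*-comm s₂ _) ⟩
    ∑ (allFin n) f₁ * s₂ ∎
    where s₂ = ∑ (allFin (n ℕ.^ k)) f₂

hom-K^× : ∀ G n k .{{_ : NonZero k}} →
  fromℕ (hom G (K n ^× k)) ≡ colouringCount (adjacent G) differ (allFin n) (vertices G) ^ℚ k
hom-K^× G n k = trans (hom-colouringCount G (K n ^× k))
  (colouringCount-power n k (adjacent G) (vertices G))

-- Cauchy products of coefficient sequences

infixl 7 _⊛_

-- The sum of `s i * t (r ∸ i)` over `i` up to `r`, unfolded along `s`.
_⊛_ : (ℕ → ℚ) → (ℕ → ℚ) → ℕ → ℚ
(s ⊛ t) zero    = s 0 * t 0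
(s ⊛ t) (suc r) = s 0 * t (suc r) + ((s ∘ suc) ⊛ t) r

VanishesAbove : ℕ → (ℕ → ℚ) → Set
VanishesAbove M s = ∀ r → M ℕ.< r → s r ≡ 0ℚ

⊛-zeroˡ : ∀ {s} t → (∀ r → s r ≡ 0ℚ) → ∀ r → (s ⊛ t) r ≡ 0ℚ
⊛-zeroˡ t s≡0 zero    = trans (cong (_* t 0) (s≡0 0)) (ℚ.*-zeroˡ (t 0))
⊛-zeroˡ t s≡0 (suc r) = cong₂ _+_
  (trans (cong (_* t (suc r)) (s≡0 0)) (ℚ.*-zeroˡ (t (suc r))))
  (⊛-zeroˡ t (s≡0 ∘ suc) r)

⊛-const : ∀ {s} t → VanishesAbove 0 s → ∀ r → (s ⊛ t) r ≡ s 0 * t r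
⊛-const     t s>0 zero    = refl
⊛-const {s} t s>0 (suc r) = trans
  (cong (s 0 * t (suc r) +_) (⊛-zeroˡ t (λ r → s>0 (suc r) (ℕ.s≤s ℕ.z≤n)) r))
  (ℚ.+-identityʳ (s 0 * t (suc r)))

⊛-vanishes : ∀ M N {s t} → VanishesAbove M s → VanishesAbove N t → VanishesAbove (M ℕ.+ N) (s ⊛ t)
⊛-vanishes zero    N {s} {t} s>0 t>N r N<r = trans (⊛-const t s>0 r)
  (trans (cong (s 0 *_) (t>N r N<r)) (ℚ.*-zeroʳ (s 0)))
⊛-vanishes (suc M) N {s} {t} s>M t>N (suc r) (ℕ.s≤s M+N<r) = cong₂ _+_
  (trans (cong (s 0 *_) (t>N (suc r) (ℕ.s≤s (ℕ.≤-trans (ℕ.m≤n+m N (suc M)) M+N<r))))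
         (ℚ.*-zeroʳ (s 0)))
  (⊛-vanishes M N (λ r M<r → s>M (suc r) (ℕ.s≤s M<r)) t>N r M+N<r)

eval-fromTop-head : ∀ s M x →
  eval (fromTop s (suc M)) x ≡ s 0 * x ^ℚ suc M + eval (fromTop (s ∘ suc) M) x
eval-fromTop-head s zero    x =
  solve 3 (λ a b x → b :+ x :* (a :+ x :* con 0ℚ) := a :* (x :* con 1ℚ) :+ (b :+ x :* con 0ℚ)) refl
    (s 0) (s 1) x
eval-fromTop-head s (suc M) x = trans
  (cong (λ v → s (suc (suc M)) + x * v) (eval-fromTop-head s M x))
  (solve 5 (λ a b x y u → b :+ x :* (a :* y :+ u) := a :* (x :* y) :+ (b :+ x :* u)) refl
    (s 0) (s (suc (suc M))) x (x ^ℚ suc M) (eval (fromTop (s ∘ suc) M) x))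

-- Since `fromTop` counts from the leading coefficient, extending the nominal degree by zeros
-- multiplies by a power of `x`.
eval-fromTop-pad : ∀ {t} K N x → VanishesAbove N t →
  eval (fromTop t (K ℕ.+ N)) x ≡ x ^ℚ K * eval (fromTop t N) x
eval-fromTop-pad     zero    N x t>N = sym (ℚ.*-identityˡ _)
eval-fromTop-pad {t} (suc K) N x t>N = begin
  t (suc (K ℕ.+ N)) + x * eval (fromTop t (K ℕ.+ N)) x
    ≡⟨ cong₂ (λ a b → a + x * b) (t>N _ (ℕ.s≤s (ℕ.m≤n+m N K))) (eval-fromTop-pad K N x t>N) ⟩
  0ℚ + x * (x ^ℚ K * eval (fromTop t N) x)
    ≡⟨ solve 3 (λ x y u → con 0ℚ :+ x :* (y :* u) := x :* y :* u) refl
         x (x ^ℚ K) (eval (fromTop t N) x) ⟩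
  x * x ^ℚ K * eval (fromTop t N) x ∎
  where open ≡-Reasoning

-- Induction on `M`, splitting off the leading term of `s`. The vanishing of `t` above `N` is what
-- lets it be padded to the nominal degree of the product.
eval-fromTop-⊛ : ∀ M N {s t} x → VanishesAbove M s → VanishesAbove N t →
  eval (fromTop (s ⊛ t) (M ℕ.+ N)) x ≡ eval (fromTop s M) x * eval (fromTop t N) x
eval-fromTop-⊛ zero    N {s} {t} x s>0 t>N = begin
  eval (fromTop (s ⊛ t) N) x                          ≡⟨ eval-fromTop-cong N x (⊛-const t s>0) ⟩
  eval (fromTop (λ r → s 0 * t r) N) x                ≡⟨ eval-fromTop-* (s 0) t N x ⟩
  s 0 * eval (fromTop t N) x
    ≡⟨ solve 3 (λ a x u → a :* u := (a :+ x :* con 0ℚ) :* u) refl (s 0) x (eval (fromTop t N) x) ⟩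
  (s 0 + x * 0ℚ) * eval (fromTop t N) x               ∎
  where open ≡-Reasoning
eval-fromTop-⊛ (suc M) N {s} {t} x s>M t>N = begin
  eval (fromTop (s ⊛ t) (suc (M ℕ.+ N))) x
    ≡⟨ eval-fromTop-head (s ⊛ t) (M ℕ.+ N) x ⟩
  s 0 * t 0 * X + eval (fromTop (λ r → s 0 * t (suc r) + ((s ∘ suc) ⊛ t) r) (M ℕ.+ N)) x
    ≡⟨ cong (s 0 * t 0 * X +_) (trans
         (eval-fromTop-+ (λ r → s 0 * t (suc r)) ((s ∘ suc) ⊛ t) (M ℕ.+ N) x)
         (cong₂ _+_ (eval-fromTop-* (s 0) (t ∘ suc) (M ℕ.+ N) x)
           (eval-fromTop-⊛ M N x (λ r M<r → s>M (suc r) (ℕ.s≤s M<r)) t>N))) ⟩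
  s 0 * t 0 * X + (s 0 * E + S * E′)
    ≡⟨ solve 6 (λ a b X e u v → a :* b :* X :+ (a :* e :+ u :* v) :=
                                a :* (b :* X :+ e) :+ u :* v) refl (s 0) (t 0) X E S E′ ⟩
  s 0 * (t 0 * X + E) + S * E′
    ≡⟨ cong (λ v → s 0 * v + S * E′) (eval-fromTop-head t (M ℕ.+ N) x) ⟨
  s 0 * eval (fromTop t (suc M ℕ.+ N)) x + S * E′
    ≡⟨ cong (λ v → s 0 * v + S * E′) (eval-fromTop-pad (suc M) N x t>N) ⟩
  s 0 * (x ^ℚ suc M * E′) + S * E′
    ≡⟨ solve 4 (λ a y e u → a :* (y :* e) :+ u :* e := (a :* y :+ u) :* e) refl
         (s 0) (x ^ℚ suc M) E′ S ⟩
  (s 0 * x ^ℚ suc M + S) * E′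
    ≡⟨ cong (_* E′) (eval-fromTop-head s M x) ⟨
  eval (fromTop s (suc M)) x * E′ ∎
  where
  open ≡-Reasoning
  X E E′ S : ℚ
  X  = x ^ℚ suc (M ℕ.+ N)
  E  = eval (fromTop (t ∘ suc) (M ℕ.+ N)) x
  E′ = eval (fromTop t N) x
  S  = eval (fromTop (s ∘ suc) M) x

infixr 8 _^⊛_

_^⊛_ : (ℕ → ℚ) → ℕ → ℕ → ℚ
(s ^⊛ zero)  zero    = 1ℚ
(s ^⊛ zero)  (suc r) = 0ℚ
(s ^⊛ suc k)         = s ⊛ (s ^⊛ k)

^⊛-vanishes : ∀ k M {s} → VanishesAbove M s → VanishesAbove (k ℕ.* M) (s ^⊛ k)
^⊛-vanishes zero    M s>M (suc r) _ = refl
^⊛-vanishes (suc k) M s>M           = ⊛-vanishes M (k ℕ.* M) s>M (^⊛-vanishes k M s>M)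

^⊛-monic : ∀ k {s} → s 0 ≡ 1ℚ → (s ^⊛ k) 0 ≡ 1ℚ
^⊛-monic zero    s₀≡1 = refl
^⊛-monic (suc k) s₀≡1 = cong₂ _*_ s₀≡1 (^⊛-monic k s₀≡1)

eval-fromTop-^⊛ : ∀ k M {s} x → VanishesAbove M s →
  eval (fromTop (s ^⊛ k) (k ℕ.* M)) x ≡ eval (fromTop s M) x ^ℚ k
eval-fromTop-^⊛ zero    M     x s>M = cong (1ℚ +_) (ℚ.*-zeroʳ x)
eval-fromTop-^⊛ (suc k) M {s} x s>M = trans
  (eval-fromTop-⊛ M (k ℕ.* M) x s>M (^⊛-vanishes k M s>M))
  (cong (eval (fromTop s M) x *_) (eval-fromTop-^⊛ k M x s>M))

IsPolynomial-⊛ : ∀ r {s t : ℕ → ℕ → ℚ} →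
  (∀ r → IsPolynomial (λ q → s q r)) → (∀ r → IsPolynomial (λ q → t q r)) →
  IsPolynomial (λ q → (s q ⊛ t q) r)
IsPolynomial-⊛ zero    s-poly t-poly = IsPolynomial-* (s-poly 0) (t-poly 0)
IsPolynomial-⊛ (suc r) s-poly t-poly = IsPolynomial-+
  (IsPolynomial-* (s-poly 0) (t-poly (suc r))) (IsPolynomial-⊛ r (s-poly ∘ suc) t-poly)

IsPolynomial-^⊛ : ∀ k {s : ℕ → ℕ → ℚ} → (∀ r → IsPolynomial (λ q → s q r)) →
                  ∀ r → IsPolynomial (λ q → (s q ^⊛ k) r)
IsPolynomial-^⊛ zero    s-poly zero    = IsPolynomial-const 1ℚ
IsPolynomial-^⊛ zero    s-poly (suc r) = IsPolynomial-const 0ℚ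
IsPolynomial-^⊛ (suc k) s-poly r       = IsPolynomial-⊛ r s-poly (IsPolynomial-^⊛ k s-poly)

-- Past the degree, the default value of `coeffFromTop` agrees with the vanishing of `s`; the
-- formula thus holds for every `r`, as infinite depth demands.
coeffFromTop-fromTop : ∀ s M → VanishesAbove M s → ∀ r → coeffFromTop (fromTop s M) M r ≡ s r
coeffFromTop-fromTop s M s>M r with r ℕ.≤? M
... | yes r≤M = trans (cong (λ b → if b then coeff (fromTop s M) (M ∸ r) else 0ℚ)
                             (dec-true (r ℕ.≤? M) r≤M))
                       (coeff-fromTop s M r r≤M)
... | no  r≰M = trans (cong (λ b → if b then coeff (fromTop s M) (M ∸ r) else 0ℚ)
                             (dec-false (r ℕ.≤? M) r≰M))
                       (sym (s>M r (ℕ.≰⇒> r≰M)))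

corollary3p11 : (k : ℕ) → .{{_ : NonZero k}} → TwoLevelTarget (λ n → K n ^× k)
corollary3p11 k G G-poly = g , (λ _ → ⊤±) , f , twoLevel , (λ _ _ → refl) , count
  where
  open ≡-Reasoning
  c : ℕ → ℕ → ℚ
  c q r = chromCoeff r (adjacent (G q)) (vertices (G q))

  d : ℕ → ℕ
  d q = k ℕ.* size (G q)

  c-vanishes : ∀ q → VanishesAbove (size (G q)) (c q)
  c-vanishes q r |G|<r = chromCoeff-vanish r (adjacent (G q)) (vertices (G q))
    (subst (ℕ._< r) (sym (length-tabulate {n = size (G q)} id)) |G|<r)

  -- The number of vertices is the sum of 1 over the vertices, hence definable and polynomial in
  -- `q`.
  d-poly : IsPolynomial (λ q → fromℕ (d q))
  d-poly = IsPolynomial-cong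
    (λ q → trans (fromℕ-* k (size (G q))) (cong (fromℕ k *_) (sym (∑-allFin-1 (size (G q))))))
    (IsPolynomial-* (IsPolynomial-const (fromℕ k))
      (IsPolynomial-definable G G-poly (Definable-sum {φ = λ _ _ → 1ℚ} (Definable-const 1ℚ))))

  g : NumericalPolynomial
  g = record
    { poly          = proj₁ d-poly
    ; integerValued = integer-valued (length (proj₁ d-poly)) (eval (proj₁ d-poly))
        (DiffVanishes-eval (proj₁ d-poly)) (λ q → ℤ.+ d q , sym (proj₂ d-poly q))
    }

  open NumericalPolynomial g using (value; integerValued)

  value-d : ∀ q → value (ℤ.+ q) ≡ ℤ.+ d q
  value-d q = fromℤ-injective
    (trans (sym (proj₂ (integerValued (ℤ.+ q)))) (sym (proj₂ d-poly q)))

  degreeAt-d : ∀ q → degreeAt g q ≡ d q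
  degreeAt-d q = cong ℤ.∣_∣ (value-d q)

  everywhere : ∀ q → q ∈S[ g ]
  everywhere q = subst (ℤ.0ℤ ℤ.≤_) (sym (value-d q)) (ℤ.+≤+ ℕ.z≤n)

  f : ℕ → Poly
  f q = fromTop (c q ^⊛ k) (d q)

  f-degree : ∀ q → HasDegree (f q) (d q)
  f-degree q =
    -- The leading coefficient is the `k`-th power of `c q 0`, which is 1.
    (λ eq → contradiction (trans (sym (trans (coeff-fromTop (c q ^⊛ k) (d q) 0 ℕ.z≤n)
                                             (^⊛-monic k refl))) eq) (λ ())) ,
    coeff-fromTop-> (c q ^⊛ k) (d q)

  φ-poly : ∀ r → IsPolynomial (λ q → (c q ^⊛ k) r)
  φ-poly = IsPolynomial-^⊛ k (IsPolynomial-chromCoeff G G-poly)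

  twoLevel : IsTwoLevelPolynomial g (λ _ → ⊤±) f
  twoLevel = record
    { eventuallyNonneg = 0 , λ q _ → everywhere q
    ; degree           = λ q _ → subst (HasDegree (f q)) (sym (degreeAt-d q)) (f-degree q)
    ; φ                = proj₁ ∘ φ-poly
    ; coefficients     = λ q _ r _ → trans
        (cong (λ D → coeffFromTop (f q) D r) (degreeAt-d q))
        (trans (coeffFromTop-fromTop (c q ^⊛ k) (d q)
                 (^⊛-vanishes k (size (G q)) (c-vanishes q)) r)
               (proj₂ (φ-poly r) q))
    ; f-outside        = λ q q∉S → contradiction (everywhere q) q∉S
    ; e-outside        = λ q q∉S → contradiction (everywhere q) q∉S
    }

  count : ∀ q n → fromℕ (hom (G q) (K n ^× k)) ≡ eval (f q) (fromℕ n)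
  count q n = begin
    fromℕ (hom (G q) (K n ^× k))
      ≡⟨ hom-K^× (G q) n k ⟩
    colouringCount (adjacent (G q)) differ (allFin n) (vertices (G q)) ^ℚ k
      ≡⟨ cong (_^ℚ k) (trans (chromatic-polynomial n (adjacent (G q)) (vertices (G q)))
           (cong (λ M → eval (fromTop (c q) M) (fromℕ n)) (length-tabulate {n = size (G q)} id))) ⟩
    eval (fromTop (c q) (size (G q))) (fromℕ n) ^ℚ k
      ≡⟨ eval-fromTop-^⊛ k (size (G q)) (fromℕ n) (c-vanishes q) ⟨
    eval (f q) (fromℕ n) ∎
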